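{- Let $(X,\Sigma,\mu)$ be a measure space and let $E$ be a Banach space over $\mathbb{R}$ with norm $\|\cdot\|$. Let $g : X\to\mathbb{R}$ be a nonnegative integrable function, and let $(f_n)_{n\in\mathbb{N}}$ be a sequence of Bochner-integrable functions $X\to E$ that converges pointwise on $X$ and such that $\|f_n(x)\|\le g(x)$ for all $n\in\mathbb{N}$ and all $x\in X$. Then the function $f : X\to E$ defined by $f(x) := \lim_{n\to\infty} f_n(x)$ is Bochner-integrable, and $$\lim_{n\to\infty}\int f_n\,d\mu = \int f\,d\mu .$$
   Context: $E$ is equipped with its Borel $\sigma$-algebra. $\int_{\mathcal{M}_+} h\,d\mu \in [0,+\infty]$ denotes the Lebesgue integral of a nonnegative measurable function $h$. A nonnegative function $g : X\to\mathbb{R}$ is integrable when it is measurable and $\int_{\mathcal{M}_+} g\,d\mu<\infty$. A function $s : X \to E$ is simple when its range is finite and all preimages $s^{ -1}(\{v\})$, $v\in E$, are measurable. A simple function $s$ is integrable when $\mu(s^{ -1}(\{v\})) < \infty$ for every $v\in E$ with $v\neq 0$; its Bochner integral is then $\int s\,d\mu := \sum_{v\in E}\mu(s^{ -1}(\{v\}))\cdot v$, a finite sum, with the convention $\infty\cdot 0_E := 0_E$. A function $f : X\to E$ is Bochner-integrable (with regard to $\mu$) when there exists a sequence $(s_n)_{n\in\mathbb{N}}$ of integrable simple functions $X\to E$ such that $s_n(x)\to f(x)$ as $n\to\infty$ for all $x\in X$, and $\int_{\mathcal{M}_+}\|f-s_n\|\,d\mu \to 0$ as $n\to\infty$. The Bochner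 integral of $f$ is then $\int f\,d\mu := \lim_{n\to\infty}\int s_n\,d\mu$ in $E$; this limit exists and does not depend on the choice of such a sequence $(s_n)$. -}

module Defs where

open import Algebra.Bundles using (CommutativeRing)
import Algebra.Construct.NaturalChoice.Max as Max
open import Algebra.Module.Bundles using (LeftModule)
open import Axiom.ExcludedMiddle using (ExcludedMiddle)
open import Data.Empty using (⊥-elim)
open import Data.List.Base using (List; foldr; map)
import Data.List.Membership.Setoid as Membership
import Data.List.Relation.Unary.Unique.Setoid as UniqueSetoid
open import Data.Nat.Base as ℕ using (ℕ; zero; suc)
open import Data.Product.Base using (Σ; Σ-syntax; ∃; ∃-syntax; _×_; _,_; proj₁; proj₂)
open import Level using (Level; Lift; lift; lower; _⊔_) renaming (suc to lsuc)
open import Relation.Binary.Bundles using (Setoid; TotalOrder)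
import Relation.Binary.Construct.Add.Supremum.NonStrict as AddSupremum
import Relation.Binary.Construct.NonStrictToStrict as Strict
import Relation.Binary.Construct.On as On
open import Relation.Binary.Core using (Rel)
open import Relation.Binary.PropositionalEquality.Core using (_≡_; _≢_; refl)
open import Relation.Binary.Structures using (IsTotalOrder)
open import Relation.Nullary.Construct.Add.Supremum using (_⁺; [_]; ⊤⁺)
open import Relation.Nullary.Decidable.Core using (Dec; yes; no; True; toWitness; fromWitness)
open import Relation.Nullary.Negation.Core using (¬_)
open import Relation.Unary using (Pred; _∈_; _⊢_; _≐_; ∁; ⋃; Satisfiable) renaming (_⊥_ to _Disjoint_)
open import Relation.Unary.Polymorphic using (∅)

private
  variable
    a p r ℓ : Level

module _ {A : Set a} (_≤_ : Rel A r) where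

  UpperBound : Pred A p → Pred A _
  UpperBound P u = ∀ {x} → x ∈ P → x ≤ u

  Supremum : Pred A p → Pred A _
  Supremum P s = UpperBound P s × (∀ {u} → UpperBound P u → s ≤ u)

-- ℝ is determined up to unique isomorphism by being a Dedekind-complete
-- ordered field, so results about ℝ quantify over all of these.
record CompleteOrderedField ℓ : Set (lsuc ℓ) where
  infix 4 _≤_
  field
    commutativeRing : CommutativeRing ℓ ℓ

  open CommutativeRing commutativeRing public

  field
    _≤_          : Rel Carrier ℓ
    isTotalOrder : IsTotalOrder _≈_ _≤_
    0≉1          : ¬ (0# ≈ 1#)
    inverse      : ∀ x → ¬ (x ≈ 0#) → ∃[ y ] x * y ≈ 1#
    +-monoʳ-≤    : ∀ x {y z} → y ≤ z → x + y ≤ x + z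
    *-nonneg     : ∀ {x y} → 0# ≤ x → 0# ≤ y → 0# ≤ x * y
    complete     : (P : Pred Carrier ℓ) → Satisfiable P →
                   ∃ (UpperBound _≤_ P) → ∃ (Supremum _≤_ P)

  totalOrder : TotalOrder ℓ ℓ ℓ
  totalOrder = record { isTotalOrder = isTotalOrder }

  module ≤ = IsTotalOrder isTotalOrder

  open Strict _≈_ _≤_ public using (_<_)

  ∣_∣ : Carrier → Carrier
  ∣ x ∣ = x ⊔ᴿ - x
    where open Max totalOrder using () renaming (_⊔_ to _⊔ᴿ_)

record BanachSpace {ℓ} (ℝ : CompleteOrderedField ℓ) : Set (lsuc ℓ) where
  private module ℝ = CompleteOrderedField ℝ
  field
    leftModule : LeftModule ℝ.ring ℓ ℓ

  open LeftModule leftModule public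

  infixl 6 _-ᴱ_
  infix 4 _⟶_

  _-ᴱ_ : Carrierᴹ → Carrierᴹ → Carrierᴹ
  u -ᴱ v = u +ᴹ (-ᴹ v)

  field
    ‖_‖              : Carrierᴹ → ℝ.Carrier
    ‖‖-cong          : ∀ {u v} → u ≈ᴹ v → ‖ u ‖ ℝ.≈ ‖ v ‖
    ‖‖-nonneg        : ∀ v → ℝ.0# ℝ.≤ ‖ v ‖
    ‖‖-definite      : ∀ v → ‖ v ‖ ℝ.≈ ℝ.0# → v ≈ᴹ 0ᴹ
    ‖‖-homogeneous   : ∀ c v → ‖ c *ₗ v ‖ ℝ.≈ ℝ.∣ c ∣ ℝ.* ‖ v ‖
    ‖‖-triangle      : ∀ u v → ‖ u +ᴹ v ‖ ℝ.≤ ‖ u ‖ ℝ.+ ‖ v ‖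

  _⟶_ : (ℕ → Carrierᴹ) → Carrierᴹ → Set ℓ
  u ⟶ l = ∀ ε → ℝ.0# ℝ.< ε → ∃[ N ] ∀ n → N ℕ.≤ n → ‖ u n -ᴱ l ‖ ℝ.< ε

  Cauchy : (ℕ → Carrierᴹ) → Set ℓ
  Cauchy u = ∀ ε → ℝ.0# ℝ.< ε →
    ∃[ N ] ∀ m n → N ℕ.≤ m → N ℕ.≤ n → ‖ u m -ᴱ u n ‖ ℝ.< ε

  field
    banach : ∀ u → Cauchy u → ∃[ l ] u ⟶ l

-- Subsets are predicates and carry no propositional extensionality, so a
-- σ-algebra has to be closed under extensional equality of subsets.
record SigmaAlgebra {ℓ} (X : Set ℓ) : Set (lsuc (lsuc ℓ)) where
  field
    Measurable : Pred (Pred X ℓ) (lsuc ℓ)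
    resp-≐     : ∀ {A B} → A ≐ B → Measurable A → Measurable B
    empty      : Measurable ∅
    complement : ∀ {A} → Measurable A → Measurable (∁ A)
    union      : ∀ {A : ℕ → Pred X ℓ} → (∀ n → Measurable (A n)) → Measurable (⋃ ℕ A)

data Generated {ℓ} {X : Set ℓ} (G : Pred (Pred X ℓ) ℓ) : Pred (Pred X ℓ) (lsuc ℓ) where
  generator      : ∀ {A} → G A → Generated G A
  gen-resp-≐     : ∀ {A B} → A ≐ B → Generated G A → Generated G B
  gen-empty      : Generated G ∅
  gen-complement : ∀ {A} → Generated G A → Generated G (∁ A)
  gen-union      : ∀ {A : ℕ → Pred X ℓ} → (∀ n → Generated G (A n)) → Generated G (⋃ ℕ A)

generatedBy : {X : Set ℓ} → Pred (Pred X ℓ) ℓ → SigmaAlgebra X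
generatedBy G = record
  { Measurable = Generated G
  ; resp-≐     = gen-resp-≐
  ; empty      = gen-empty
  ; complement = gen-complement
  ; union      = gen-union
  }

MeasurableMap : {X Y : Set ℓ} → SigmaAlgebra X → SigmaAlgebra Y → (X → Y) → Set (lsuc ℓ)
MeasurableMap 𝓐 𝓑 h = ∀ {B} → SigmaAlgebra.Measurable 𝓑 B → SigmaAlgebra.Measurable 𝓐 (h ⊢ B)

module _ (ℝ : CompleteOrderedField ℓ) where
  open CompleteOrderedField ℝ

  IsOpen : Pred (Pred Carrier ℓ) ℓ
  IsOpen U = ∀ {x} → x ∈ U → ∃[ ε ] 0# < ε × (∀ {y} → ∣ y - x ∣ < ε → y ∈ U)

  borel : SigmaAlgebra Carrier
  borel = generatedBy IsOpen

-- The fibre condition uses the equality of S; `values` may list points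
-- outside the range, whose fibres are empty.
record IsSimple {ℓ} {X : Set ℓ} (𝓐 : SigmaAlgebra X) (S : Setoid ℓ ℓ)
                (s : X → Setoid.Carrier S) : Set (lsuc ℓ) where
  open Setoid S using (Carrier; _≈_)
  open Membership S using () renaming (_∈_ to _∈ₗ_)
  open UniqueSetoid S using (Unique)
  field
    values : List Carrier
    unique : Unique values
    range  : ∀ x → s x ∈ₗ values
    fibre  : ∀ v → SigmaAlgebra.Measurable 𝓐 (λ x → s x ≈ v)

module ExtendedReals (ℝ : CompleteOrderedField ℓ) where
  open CompleteOrderedField ℝ

  ℝ≥0 : Set ℓ
  ℝ≥0 = Σ[ x ∈ Carrier ] 0# ≤ x

  ℝ≥0-setoid : Setoid ℓ ℓ
  ℝ≥0-setoid = On.setoid {B = ℝ≥0} setoid proj₁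

  [0,∞] : Set ℓ
  [0,∞] = ℝ≥0 ⁺

  pattern ∞ = ⊤⁺

  _≤ℝ≥0_ : Rel ℝ≥0 ℓ
  x ≤ℝ≥0 y = proj₁ x ≤ proj₁ y

  open AddSupremum _≤ℝ≥0_ public using (_≤⁺_; _≤⊤⁺) renaming ([_] to [_]≤)

  infix 4 _≈∞_
  _≈∞_ : Rel [0,∞] ℓ
  x ≈∞ y = x ≤⁺ y × y ≤⁺ x

  0∞ : [0,∞]
  0∞ = [ 0# , ≤.refl ]

  infixl 6 _+∞_
  _+∞_ : [0,∞] → [0,∞] → [0,∞]
  [ x , 0≤x ] +∞ [ y , 0≤y ] = [ x + y , 0≤x+y ]
    where
    0≤x+y : 0# ≤ x + y
    0≤x+y = ≤.trans 0≤x (≤.trans (≤.reflexive (sym (+-identityʳ x))) (+-monoʳ-≤ x 0≤y))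
  [ _ ] +∞ ∞ = ∞
  ∞     +∞ _ = ∞

  partialSum : (ℕ → [0,∞]) → ℕ → [0,∞]
  partialSum x zero    = 0∞
  partialSum x (suc n) = partialSum x n +∞ x n

  IsSeriesSum : (ℕ → [0,∞]) → [0,∞] → Set ℓ
  IsSeriesSum x = Supremum _≤⁺_ λ y → ∃[ n ] y ≡ partialSum x n

  infix 4 _⟶0
  _⟶0 : (ℕ → [0,∞]) → Set ℓ
  x ⟶0 = ∀ ε → 0# < ε → (0≤ε : 0# ≤ ε) → ∃[ N ] ∀ n → N ℕ.≤ n → x n ≤⁺ [ ε , 0≤ε ]

record MeasureSpace {ℓ} (ℝ : CompleteOrderedField ℓ) : Set (lsuc (lsuc ℓ)) where
  open ExtendedReals ℝ
  field
    Point        : Set ℓ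
    sigmaAlgebra : SigmaAlgebra Point

  open SigmaAlgebra sigmaAlgebra public

  field
    μ      : ∀ A → Measurable A → [0,∞]
    μ-cong : ∀ {A B} (mA : Measurable A) (mB : Measurable B) → A ≐ B → μ A mA ≈∞ μ B mB
    μ-∅    : μ ∅ empty ≈∞ 0∞
    μ-⋃    : ∀ {A : ℕ → Pred Point ℓ} (mA : ∀ n → Measurable (A n)) →
             (∀ {m n} → m ≢ n → A m Disjoint A n) →
             IsSeriesSum (λ n → μ (A n) (mA n)) (μ (⋃ ℕ A) (union mA))

module Integration (em : ∀ {a} → ExcludedMiddle a)
                   {ℝ : CompleteOrderedField ℓ} (M : MeasureSpace ℝ) where
  open CompleteOrderedField ℝ
  open ExtendedReals ℝ
  open MeasureSpace M

  infixr 7 _·∞_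
  _·∞_ : ℝ≥0 → [0,∞] → [0,∞]
  (x , 0≤x) ·∞ [ y , 0≤y ] = [ x * y , *-nonneg 0≤x 0≤y ]
  (x , _)   ·∞ ∞ with em {P = x ≈ 0#}
  ... | yes _ = 0∞
  ... | no  _ = ∞

  -- Completeness of ℝ only speaks of predicates in Set ℓ; excluded middle
  -- brings P down to that level.
  supremum : (P : Pred [0,∞] p) → ∃ (Supremum _≤⁺_ P)
  supremum P with em {P = P ∞}
  ... | yes P∞ = ∞ , (λ {x} _ → x ≤⊤⁺) , λ ub → ub P∞
  ... | no ¬P∞ = finite em em
    where
    finitePart : Pred Carrier ℓ
    finitePart x = Lift ℓ (True (em {P = Σ[ 0≤x ∈ 0# ≤ x ] P [ x , 0≤x ]}))

    into : ∀ {x} 0≤x → P [ x , 0≤x ] → finitePart x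
    into 0≤x Px = lift (fromWitness (0≤x , Px))

    finite : Dec (Satisfiable finitePart) → Dec (∃ (UpperBound _≤_ finitePart)) →
             ∃ (Supremum _≤⁺_ P)
    finite (no ∄x) _ = 0∞ , ub , λ {u} _ → 0∞≤ u
      where
      ub : UpperBound _≤⁺_ P 0∞
      ub {[ x , 0≤x ]} Px = ⊥-elim (∄x (x , into 0≤x Px))
      ub {∞}           P∞ = ⊥-elim (¬P∞ P∞)
      0∞≤ : ∀ u → 0∞ ≤⁺ u
      0∞≤ [ _ , 0≤u ] = [ 0≤u ]≤
      0∞≤ ∞           = 0∞ ≤⊤⁺
    finite (yes _) (no unbounded) = ∞ , (λ {x} _ → x ≤⊤⁺) , least
      where
      least : ∀ {u} → UpperBound _≤⁺_ P u → ∞ ≤⁺ u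
      least {∞}           _  = ∞ ≤⊤⁺
      least {[ u , 0≤u ]} ub = ⊥-elim (unbounded (u , bound))
        where
        bound : UpperBound _≤_ finitePart u
        bound (lift t) with toWitness t
        ... | 0≤x , Px with ub Px
        ... | [ x≤u ]≤ = x≤u
    finite (yes (x₀ , q₀)) (yes bounded) with complete finitePart (x₀ , q₀) bounded
    ... | s , s-ub , s-least = [ s , 0≤s ] , ub , least
      where
      0≤s : 0# ≤ s
      0≤s = ≤.trans (proj₁ (toWitness (lower q₀))) (s-ub q₀)
      ub : UpperBound _≤⁺_ P [ s , 0≤s ]
      ub {[ x , 0≤x ]} Px = [ s-ub (into 0≤x Px) ]≤
      ub {∞}           P∞ = ⊥-elim (¬P∞ P∞)
      least : ∀ {u} → UpperBound _≤⁺_ P u → [ s , 0≤s ] ≤⁺ u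
      least {∞}           _   = [ s , 0≤s ] ≤⊤⁺
      least {[ u , 0≤u ]} ub′ = [ s-least bound ]≤
        where
        bound : UpperBound _≤_ finitePart u
        bound (lift t) with toWitness t
        ... | 0≤x , Px with ub′ Px
        ... | [ x≤u ]≤ = x≤u

  sup : Pred [0,∞] p → [0,∞]
  sup P = proj₁ (supremum P)

  simpleLebesgue : (φ : Point → ℝ≥0) → IsSimple sigmaAlgebra ℝ≥0-setoid φ → [0,∞]
  simpleLebesgue φ φ-simple = foldr _+∞_ 0∞ (map (λ y → y ·∞ μ _ (fibre y)) values)
    where open IsSimple φ-simple

  -- Meaningful for h nonnegative and measurable.
  ∫⁺ : (Point → Carrier) → [0,∞]
  ∫⁺ h = sup λ I → Σ[ φ ∈ (Point → ℝ≥0) ] Σ[ φ-simple ∈ IsSimple sigmaAlgebra ℝ≥0-setoid φ ]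
    (∀ x → proj₁ (φ x) ≤ h x) × I ≡ simpleLebesgue φ φ-simple

  NonnegIntegrable : (Point → Carrier) → Set (lsuc ℓ)
  NonnegIntegrable g = MeasurableMap sigmaAlgebra (borel ℝ) g × ∫⁺ g ≢ ∞

  module Bochner (E : BanachSpace ℝ) where
    open BanachSpace E

    -- The default value is never reached for the sequences in `∫`.
    lim : (ℕ → Carrierᴹ) → Carrierᴹ
    lim u with em {P = ∃[ l ] u ⟶ l}
    ... | yes (l , _) = l
    ... | no  _       = 0ᴹ

    -- For integrable simple functions, ∞ is only ever paired with 0ᴹ.
    infixr 7 _·ᴱ_
    _·ᴱ_ : [0,∞] → Carrierᴹ → Carrierᴹ
    [ c , _ ] ·ᴱ v = c *ₗ v
    ∞         ·ᴱ v = 0ᴹ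

    record IntegrableSimple (s : Point → Carrierᴹ) : Set (lsuc ℓ) where
      field
        isSimple     : IsSimple sigmaAlgebra ≈ᴹ-setoid s
      open IsSimple isSimple public
      field
        finiteFibres : ∀ v → v ≉ᴹ 0ᴹ → μ _ (fibre v) ≢ ∞

    simpleIntegral : {s : Point → Carrierᴹ} → IntegrableSimple s → Carrierᴹ
    simpleIntegral s-int = foldr _+ᴹ_ 0ᴹ (map (λ v → μ _ (fibre v) ·ᴱ v) values)
      where open IntegrableSimple s-int

    -- Each ‖ f - sₙ ‖ is measurable, since f is a pointwise limit of simple
    -- functions.
    record BochnerIntegrable (f : Point → Carrierᴹ) : Set (lsuc ℓ) where
      field
        approx       : ℕ → Point → Carrierᴹ
        isIntegrable : ∀ n → IntegrableSimple (approx n)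
        pointwise    : ∀ x → (λ n → approx n x) ⟶ f x
        inMean       : (λ n → ∫⁺ (λ x → ‖ f x -ᴱ approx n x ‖)) ⟶0

    ∫ : (f : Point → Carrierᴹ) → BochnerIntegrable f → Carrierᴹ
    ∫ f f-int = lim (λ n → simpleIntegral (isIntegrable n))
      where open BochnerIntegrable f-int

{-# OPTIONS --safe #-}
module Submission where

-- Write finite-measure step functions as formal sums of pairs (A , v). If their values lie
-- in a convex cone K, so does the integral Σ μ(A) v: split the space along one set at a
-- time until all summands are constant. With K = {b ≥ 0} this is monotonicity, and with
-- K = {(v , b) : ‖v‖ ≤ b} it is ‖∫ s‖ ≤ ∫ ‖s‖.
-- Scalar dominated convergence: take a simple φ ≤ g with ∫ φ nearly ∫⁺ g. A simple
-- ψ ≤ h n ≤ g is at most ((ψ ⊔ φ) − φ) + (ψ ⊓ φ); the first part has small integral, and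
-- the second is small by continuity of μ from above on the sets where some later h m ≥ δ.
-- The limit f∞ is approximated by its nearest point among 0 and finitely many values of
-- the approximants of the f n; as 0 competes, the error never exceeds ‖f∞‖ ≤ g.

open import Algebra.Module.Bundles using (LeftModule)
import Algebra.Construct.NaturalChoice.Max as Max
import Algebra.Module.Construct.DirectProduct as DirectProduct
import Algebra.Module.Construct.TensorUnit as TensorUnit
import Algebra.Module.Properties.LeftModule as LeftModuleProperties
import Algebra.Properties.AbelianGroup as AbelianGroupProperties
import Algebra.Properties.Ring as RingProperties
import Algebra.Solver.CommutativeMonoid as CommutativeMonoidSolver
import Algebra.Solver.Ring.NaturalCoefficients.Default as SemiringSolver
open import Axiom.ExcludedMiddle using (ExcludedMiddle)
open import Data.Empty using (⊥-elim)
open import Data.List.Base using (List; []; _∷_; _++_; map; foldr; upTo; cartesianProduct; cartesianProductWith; deduplicate)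
open import Data.List.Membership.Propositional using () renaming (_∈_ to _∈ₚ_)
open import Data.List.Membership.Propositional.Properties using (∈-cartesianProduct⁺; ∈-upTo⁺)
import Data.List.Membership.Setoid as Membership
import Data.List.Membership.Setoid.Properties as MembershipProperties
open import Data.List.Relation.Unary.All as All using (All; []; _∷_)
open import Data.List.Relation.Unary.AllPairs using ([]; _∷_)
open import Data.List.Relation.Unary.Any using (Any; here; there)
import Data.List.Relation.Unary.Unique.DecSetoid.Properties as UniqueProperties
import Data.List.Relation.Unary.Unique.Setoid as UniqueSetoid
open import Data.Nat.Base as ℕ using (ℕ; zero; suc)
open import Data.Nat.GeneralisedArithmetic using (iterate)
import Data.Nat.Properties as ℕ
open import Data.Product.Base using (Σ-syntax; ∃; ∃-syntax; _×_; _,_; proj₁; proj₂)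
open import Data.Sum.Base using (_⊎_; inj₁; inj₂)
open import Function.Base using (_∘_)
open import Level using (lift) renaming (suc to lsuc)
open import Relation.Binary.Bundles using (Setoid; DecSetoid; TotalOrder)
import Relation.Binary.Construct.Add.Supremum.NonStrict as AddSupremum
open import Relation.Binary.Core using (_Preserves₂_⟶_⟶_)
open import Relation.Binary.Definitions using (tri<; tri≈; tri>)
import Relation.Binary.Properties.TotalOrder as TotalOrderProperties
open import Relation.Binary.PropositionalEquality.Core as ≡ using (_≡_; _≢_)
import Relation.Binary.Reasoning.PartialOrder as PosetReasoning
import Relation.Binary.Reasoning.Setoid as SetoidReasoning
open import Relation.Nullary.Construct.Add.Supremum using ([_])
open import Relation.Nullary.Decidable.Core using (yes; no)
open import Relation.Nullary.Negation.Core using (¬_)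
open import Relation.Unary using (Pred; _∈_; _∉_; _⊆_; _≐_; _∪_; _∩_; ∁; ⋃) renaming (_⊥_ to _Disjoint_)
open import Relation.Unary.Polymorphic using (∅)
open import Defs

-- `∫⁺` is a bare supremum over simple minorants, with no additivity to start from. Every bound on
-- it is therefore reduced to finite sums: each minorant gets a step function of its own as
-- majorant. Sums of integrands are estimated up to a factor 2, which a limit argument absorbs;
-- hence the divisions of ε by 8 and 32. Both conclusions rest on the same scalar statement. Applied
-- to ‖f∞ - s k‖ for the approximants s k of f∞, it gives convergence in mean. Applied to half of ‖f
-- n - f∞‖, it brings the integrals together: they are compared through simple functions s near f n
-- and t near f∞, because ‖∫ s - ∫ t‖ is bounded by ∫⁺ ‖s - t‖. Bochner integrability asks for
-- convergence at every point, while a diagonal choice of approximants controls only the mean.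
-- Nearest points converge everywhere, at the price of showing that the set where one candidate is
-- nearer than another is measurable. As E may be nonseparable, this is deduced from f∞ being an
-- iterated limit of simple functions.

-- Ordered-field arithmetic, halving and the Archimedean property

module OrderedField (em : ∀ {a} → ExcludedMiddle a) {ℓ} (ℝ : CompleteOrderedField ℓ) where
  open CompleteOrderedField ℝ hiding (zero)
  open TotalOrderProperties totalOrder public using (≰⇒>; <⇒≱)
  module ≤-Reasoning = PosetReasoning (TotalOrder.poset totalOrder)
  module Solver = SemiringSolver commutativeSemiring
  open Max totalOrder public using (_⊔_; x≤x⊔y; x≤y⊔x; ⊔-lub; x≤y⇒y⊔x≈y; x≤y⇒x⊔y≈y; ⊔-cong)
  open RingProperties ring public using (-‿involutive; -1*x≈-x; -‿distribʳ-*)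
  open ≤-Reasoning

  ≤-or-> : ∀ x y → x ≤ y ⊎ y < x
  ≤-or-> x y with em {P = x ≤ y}
  ... | yes p = inj₁ p
  ... | no ¬p = inj₂ (≰⇒> ¬p)

  ≮⇒≥ : ∀ {x y} → ¬ (x < y) → y ≤ x
  ≮⇒≥ {x} {y} x≮y with ≤-or-> y x
  ... | inj₁ p = p
  ... | inj₂ p = ⊥-elim (x≮y p)

  ≤-<-trans : ∀ {x y z} → x ≤ y → y < z → x < z
  ≤-<-trans {x} {y} {z} p q = begin-strict x ≤⟨ p ⟩ y <⟨ q ⟩ z ∎

  +-mono-≤ : ∀ {a b c d} → a ≤ b → c ≤ d → a + c ≤ b + d
  +-mono-≤ {a} {b} {c} {d} a≤b c≤d = begin
    a + c ≤⟨ +-monoʳ-≤ a c≤d ⟩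
    a + d ≈⟨ +-comm a d ⟩
    d + a ≤⟨ +-monoʳ-≤ d a≤b ⟩
    d + b ≈⟨ +-comm d b ⟩
    b + d ∎

  +-cancelʳ-≤ : ∀ {a b} c → a + c ≤ b + c → a ≤ b
  +-cancelʳ-≤ {a} {b} c p = begin
    a             ≈⟨ undo a ⟨
    a + c + - c   ≤⟨ +-mono-≤ p ≤.refl ⟩
    b + c + - c   ≈⟨ undo b ⟩
    b             ∎
    where
    undo : ∀ x → x + c + - c ≈ x
    undo x = trans (+-assoc x c (- c)) (trans (+-congˡ (-‿inverseʳ c)) (+-identityʳ x))

  +-cancelˡ-≤ : ∀ {a b} c → c + a ≤ c + b → a ≤ b
  +-cancelˡ-≤ {a} {b} c p = +-cancelʳ-≤ c (begin
    a + c ≈⟨ +-comm a c ⟩ c + a ≤⟨ p ⟩ c + b ≈⟨ +-comm c b ⟩ b + c ∎)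

  +-monoˡ-< : ∀ {a b c d} → a < b → c ≤ d → a + c < b + d
  +-monoˡ-< {a} {b} {c} {d} a<b c≤d = ≰⇒> λ q → <⇒≱ a<b (+-cancelʳ-≤ c (≤.trans (+-mono-≤ ≤.refl c≤d) q))

  0≤+ : ∀ {a b} → 0# ≤ a → 0# ≤ b → 0# ≤ a + b
  0≤+ p q = ≤.trans (≤.reflexive (sym (+-identityʳ 0#))) (+-mono-≤ p q)

  0<+ : ∀ {a b} → 0# < a → 0# < b → 0# < a + b
  0<+ p q = ≤-<-trans (≤.reflexive (sym (+-identityʳ 0#))) (+-monoˡ-< p (proj₁ q))

  x≤x+y : ∀ {x y} → 0# ≤ y → x ≤ x + y
  x≤x+y {x} {y} p = begin x ≈⟨ +-identityʳ x ⟨ x + 0# ≤⟨ +-monoʳ-≤ x p ⟩ x + y ∎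

  x≤y+x : ∀ {x y} → 0# ≤ y → x ≤ y + x
  x≤y+x {x} {y} p = ≤.trans (x≤x+y p) (≤.reflexive (+-comm x y))

  x<x+y : ∀ {x y} → 0# < y → x < x + y
  x<x+y {x} {y} p = ≰⇒> λ q → <⇒≱ p (+-cancelˡ-≤ x (≤.trans q (≤.reflexive (sym (+-identityʳ x)))))

  x+[y-x]≈y : ∀ x y → x + (y - x) ≈ y
  x+[y-x]≈y x y = trans (sym (+-assoc x y (- x))) (trans (+-congʳ (+-comm x y))
    (trans (+-assoc y x (- x)) (trans (+-congˡ (-‿inverseʳ x)) (+-identityʳ y))))

  x≤y⇒0≤y-x : ∀ {x y} → x ≤ y → 0# ≤ y - x
  x≤y⇒0≤y-x {x} {y} p = +-cancelˡ-≤ x (begin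
    x + 0# ≈⟨ +-identityʳ x ⟩ x ≤⟨ p ⟩ y ≈⟨ x+[y-x]≈y x y ⟨ x + (y - x) ∎)

  0≤y-x⇒x≤y : ∀ {x y} → 0# ≤ y - x → x ≤ y
  0≤y-x⇒x≤y {x} {y} p = ≤.trans (x≤x+y p) (≤.reflexive (x+[y-x]≈y x y))

  x<y⇒0<y-x : ∀ {x y} → x < y → 0# < y - x
  x<y⇒0<y-x {x} {y} p = x≤y⇒0≤y-x (proj₁ p) , λ e → proj₂ p
    (trans (sym (+-identityʳ x)) (trans (+-congˡ e) (x+[y-x]≈y x y)))

  *-monoˡ-≤ : ∀ {c x y} → 0# ≤ c → x ≤ y → c * x ≤ c * y
  *-monoˡ-≤ {c} {x} {y} 0≤c x≤y = begin
    c * x                  ≤⟨ x≤x+y (*-nonneg 0≤c (x≤y⇒0≤y-x x≤y)) ⟩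
    c * x + c * (y - x)    ≈⟨ distribˡ c x (y - x) ⟨
    c * (x + (y - x))      ≈⟨ *-congˡ (x+[y-x]≈y x y) ⟩
    c * y                  ∎

  0<1 : 0# < 1#
  0<1 with ≤.total 0# 1#
  ... | inj₁ p = p , 0≉1
  -- If 1 ≤ 0, then -1 is nonnegative, and so is its square, which is 1.
  ... | inj₂ 1≤0 = (begin
      0#              ≤⟨ *-nonneg 0≤-1 0≤-1 ⟩
      - 1# * - 1#     ≈⟨ -1*x≈-x (- 1#) ⟩
      - - 1#          ≈⟨ -‿involutive 1# ⟩
      1#              ∎) , 0≉1
    where
    0≤-1 : 0# ≤ - 1#
    0≤-1 = ≤.trans (x≤y⇒0≤y-x 1≤0) (≤.reflexive (+-identityˡ (- 1#)))

  half : ∃[ h ] h + h ≈ 1#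
  half with inverse (1# + 1#) (λ e → proj₂ (0<+ 0<1 0<1) (sym e))
  ... | h , e = h , trans (+-cong (sym (*-identityˡ h)) (sym (*-identityˡ h)))
                          (trans (sym (distribʳ h 1# 1#)) e)

  halve : ∀ x → ∃[ y ] y + y ≈ x
  halve x with half
  ... | h , e = h * x , trans (sym (distribʳ x h h)) (trans (*-congʳ e) (*-identityˡ x))

  halve-nonneg : ∀ {x y} → y + y ≈ x → 0# ≤ x → 0# ≤ y
  halve-nonneg {x} {y} e 0≤x with ≤-or-> 0# y
  ... | inj₁ p = p
  ... | inj₂ y<0 = ⊥-elim (<⇒≱ (begin-strict
    x     ≈⟨ e ⟨
    y + y <⟨ +-monoˡ-< y<0 (proj₁ y<0) ⟩
    0# + 0# ≈⟨ +-identityʳ 0# ⟩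
    0# ∎) 0≤x)

  halve-pos : ∀ {x y} → y + y ≈ x → 0# < x → 0# < y
  halve-pos {x} {y} e 0<x = halve-nonneg e (proj₁ 0<x) , λ 0≈y →
    proj₂ 0<x (trans (sym (+-identityʳ 0#)) (trans (+-cong 0≈y 0≈y) e))

  double-cancel-≤ : ∀ {x y} → x + x ≤ y + y → x ≤ y
  double-cancel-≤ {x} {y} p with ≤-or-> x y
  ... | inj₁ x≤y = x≤y
  ... | inj₂ y<x = ⊥-elim (<⇒≱ (+-monoˡ-< y<x (proj₁ y<x)) p)

  double-cancel : ∀ {x y} → x + x ≈ y + y → x ≈ y
  double-cancel e = ≤.antisym (double-cancel-≤ (≤.reflexive e)) (double-cancel-≤ (≤.reflexive (sym e)))

  halve⁺ : ∀ {ε} → 0# < ε → ∃[ δ ] 0# < δ × δ + δ ≈ ε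
  halve⁺ {ε} p with halve ε
  ... | δ , e = δ , halve-pos e p , e

  ≤-of-≤+ε : ∀ {a b} → (∀ ε → 0# < ε → a ≤ b + ε) → a ≤ b
  ≤-of-≤+ε {a} {b} h with ≤-or-> a b
  ... | inj₁ p = p
  ... | inj₂ b<a with halve⁺ (x<y⇒0<y-x b<a)
  ... | δ , 0<δ , e = ⊥-elim (<⇒≱ (x<x+y 0<δ) (begin
    b + δ + δ       ≈⟨ +-assoc b δ δ ⟩
    b + (δ + δ)     ≈⟨ +-congˡ e ⟩
    b + (a - b)     ≈⟨ x+[y-x]≈y b a ⟩
    a               ≤⟨ h δ 0<δ ⟩
    b + δ           ∎))

  -- Powers of ½, paired with the positivity that the next halving requires. They are the countable
  -- supply of tolerances over which measurability arguments take unions.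
  null⁺ : ℕ → Σ[ ε ∈ Carrier ] 0# < ε
  null⁺ zero    = 1# , 0<1
  null⁺ (suc n) = proj₁ (halve⁺ (proj₂ (null⁺ n))) , proj₁ (proj₂ (halve⁺ (proj₂ (null⁺ n))))

  null : ℕ → Carrier
  null n = proj₁ (null⁺ n)

  null-suc : ∀ n → null (suc n) + null (suc n) ≈ null n
  null-suc n = proj₂ (proj₂ (halve⁺ (proj₂ (null⁺ n))))

  -- The lower bounds of all powers of ½ are closed under addition, so their
  -- supremum s satisfies s + ε ≤ s for each of them.
  null-small : ∀ {c} → 0# < c → ∃[ n ] null n < c
  null-small {c} 0<c with em {P = ∃[ n ] null n < c}
  ... | yes p = p
  ... | no ¬p = ⊥-elim (<⇒≱ (x<x+y {s} 0<c) (≤-below s+c≤s))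
    where
    Below : Carrier → Set ℓ
    Below x = ∀ n → x ≤ null n
    c-below : Below c
    c-below n = ≮⇒≥ λ q → ¬p (n , q)
    +-below : ∀ {x y} → Below x → Below y → Below (x + y)
    +-below p q n = ≤.trans (+-mono-≤ (p (suc n)) (q (suc n))) (≤.reflexive (null-suc n))
    sup : ∃ (Supremum _≤_ Below)
    sup = complete Below (c , c-below) (null 0 , λ p → p 0)
    s = proj₁ sup
    s+c≤s : ∀ {x} → Below x → x ≤ s - c
    s+c≤s {x} p = +-cancelʳ-≤ c (begin
      x + c         ≤⟨ proj₁ (proj₂ sup) (+-below p c-below) ⟩
      s             ≈⟨ x+[y-x]≈y c s ⟨
      c + (s - c)   ≈⟨ +-comm c (s - c) ⟩
      s - c + c     ∎)
    ≤-below : (∀ {x} → Below x → x ≤ s - c) → s + c ≤ s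
    ≤-below ub = begin
      s + c         ≤⟨ +-mono-≤ (proj₂ (proj₂ sup) ub) ≤.refl ⟩
      s - c + c     ≈⟨ +-comm (s - c) c ⟩
      c + (s - c)   ≈⟨ x+[y-x]≈y c s ⟩
      s             ∎

  -- ε is divided by `K + 1` instead of `K`, which covers `K = 0`.
  small-multiple : ∀ {K ε} → 0# ≤ K → 0# < ε → ∃[ δ ] 0# < δ × δ * K ≤ ε
  small-multiple {K} {ε} 0≤K 0<ε with inverse (K + 1#) (λ e → <⇒≱ 0<1 (≤.trans (x≤y+x 0≤K) (≤.reflexive e)))
  ... | y , e = δ , (0≤δ , λ 0≈δ → proj₂ 0<ε (trans (sym (zeroˡ (K + 1#))) (trans (*-congʳ 0≈δ) δ[K+1]≈ε))) , (begin
      δ * K          ≤⟨ *-monoˡ-≤ 0≤δ (x≤x+y (proj₁ 0<1)) ⟩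
      δ * (K + 1#)   ≈⟨ δ[K+1]≈ε ⟩
      ε              ∎)
    where
    δ = ε * y
    δ[K+1]≈ε : δ * (K + 1#) ≈ ε
    δ[K+1]≈ε = trans (*-assoc ε y (K + 1#)) (trans (*-congˡ (trans (*-comm y (K + 1#)) e)) (*-identityʳ ε))
    0≤y : 0# ≤ y
    0≤y with ≤.total 0# y
    ... | inj₁ p = p
    ... | inj₂ y≤0 = ⊥-elim (<⇒≱ 0<1 (begin
        1#                ≈⟨ e ⟨
        (K + 1#) * y      ≤⟨ *-monoˡ-≤ (0≤+ 0≤K (proj₁ 0<1)) y≤0 ⟩
        (K + 1#) * 0#     ≈⟨ zeroʳ (K + 1#) ⟩
        0#                ∎))
    0≤δ : 0# ≤ δ
    0≤δ = *-nonneg (proj₁ 0<ε) 0≤y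

-- Norm and distance estimates

module Norm (em : ∀ {a} → ExcludedMiddle a) {ℓ} (ℝ : CompleteOrderedField ℓ) (E : BanachSpace ℝ) where
  open CompleteOrderedField ℝ hiding (zero)
  open OrderedField em ℝ
  open BanachSpace E
  open LeftModuleProperties leftModule using (inverseˡ-uniqueᴹ)
  open ≤-Reasoning

  0≤x⇒∣x∣≈x : ∀ {x} → 0# ≤ x → ∣ x ∣ ≈ x
  0≤x⇒∣x∣≈x {x} 0≤x = x≤y⇒y⊔x≈y (+-cancelʳ-≤ x (begin
    - x + x  ≈⟨ -‿inverseˡ x ⟩
    0#       ≤⟨ 0≤+ 0≤x 0≤x ⟩
    x + x    ∎))

  ∣-1∣≈1 : ∣ - 1# ∣ ≈ 1#
  ∣-1∣≈1 = trans (x≤y⇒x⊔y≈y (+-cancelʳ-≤ 1# (begin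
    - 1# + 1#      ≈⟨ -‿inverseˡ 1# ⟩
    0#             ≤⟨ 0≤+ (proj₁ 0<1) (proj₁ 0<1) ⟩
    1# + 1#        ≈⟨ +-congʳ (-‿involutive 1#) ⟨
    - - 1# + 1#    ∎))) (-‿involutive 1#)

  ‖‖-zero : ∀ {v} → v ≈ᴹ 0ᴹ → ‖ v ‖ ≈ 0#
  ‖‖-zero {v} v≈0 = trans (‖‖-cong (≈ᴹ-trans v≈0 (≈ᴹ-sym (*ₗ-zeroˡ 0ᴹ)))) (trans (‖‖-homogeneous 0# 0ᴹ)
    (trans (*-congʳ (0≤x⇒∣x∣≈x ≤.refl)) (zeroˡ ‖ 0ᴹ ‖)))

  ‖‖-scale : ∀ {c} v → 0# ≤ c → ‖ c *ₗ v ‖ ≈ c * ‖ v ‖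
  ‖‖-scale {c} v 0≤c = trans (‖‖-homogeneous c v) (*-congʳ (0≤x⇒∣x∣≈x 0≤c))

  -1*ₗ : ∀ v → (- 1#) *ₗ v ≈ᴹ -ᴹ v
  -1*ₗ v = inverseˡ-uniqueᴹ _ _ (≈ᴹ-trans (+ᴹ-congˡ (≈ᴹ-sym (*ₗ-identityˡ v)))
    (≈ᴹ-trans (≈ᴹ-sym (*ₗ-distribʳ v (- 1#) 1#)) (≈ᴹ-trans (*ₗ-congʳ (-‿inverseˡ 1#)) (*ₗ-zeroˡ v))))

  ‖-‖ : ∀ v → ‖ -ᴹ v ‖ ≈ ‖ v ‖
  ‖-‖ v = trans (‖‖-cong (≈ᴹ-sym (-1*ₗ v))) (trans (‖‖-homogeneous (- 1#) v) (trans (*-congʳ ∣-1∣≈1) (*-identityˡ ‖ v ‖)))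

  -ᴱ-telescope : ∀ u v w → (u -ᴱ v) +ᴹ (v -ᴱ w) ≈ᴹ u -ᴱ w
  -ᴱ-telescope u v w = ≈ᴹ-trans (+ᴹ-assoc u (-ᴹ v) (v -ᴱ w)) (+ᴹ-congˡ
    (≈ᴹ-trans (≈ᴹ-sym (+ᴹ-assoc (-ᴹ v) v (-ᴹ w))) (≈ᴹ-trans (+ᴹ-congʳ (-ᴹ‿inverseˡ v)) (+ᴹ-identityˡ (-ᴹ w)))))

  -ᴱ-cong : ∀ {u u′ v v′} → u ≈ᴹ u′ → v ≈ᴹ v′ → u -ᴱ v ≈ᴹ u′ -ᴱ v′
  -ᴱ-cong p q = +ᴹ-cong p (-ᴹ‿cong q)

  u-u≈0 : ∀ u → ‖ u -ᴱ u ‖ ≈ 0#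
  u-u≈0 u = ‖‖-zero (-ᴹ‿inverseʳ u)

  u-0≈u : ∀ u → u -ᴱ 0ᴹ ≈ᴹ u
  u-0≈u u = ≈ᴹ-trans (+ᴹ-congˡ (≈ᴹ-trans (≈ᴹ-sym (+ᴹ-identityˡ _)) (-ᴹ‿inverseʳ 0ᴹ))) (+ᴹ-identityʳ u)

  dist-sym : ∀ u v → ‖ u -ᴱ v ‖ ≈ ‖ v -ᴱ u ‖
  dist-sym u v = trans (sym (‖-‖ (u -ᴱ v))) (‖‖-cong (≈ᴹ-sym (inverseˡ-uniqueᴹ _ _
    (≈ᴹ-trans (-ᴱ-telescope v u v) (-ᴹ‿inverseʳ v)))))

  dist-triangle : ∀ u v w → ‖ u -ᴱ w ‖ ≤ ‖ u -ᴱ v ‖ + ‖ v -ᴱ w ‖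
  dist-triangle u v w = begin
    ‖ u -ᴱ w ‖                    ≈⟨ ‖‖-cong (-ᴱ-telescope u v w) ⟨
    ‖ (u -ᴱ v) +ᴹ (v -ᴱ w) ‖      ≤⟨ ‖‖-triangle _ _ ⟩
    ‖ u -ᴱ v ‖ + ‖ v -ᴱ w ‖       ∎

  dist-triangleˡ : ∀ u v w → ‖ u -ᴱ w ‖ ≤ ‖ v -ᴱ u ‖ + ‖ v -ᴱ w ‖
  dist-triangleˡ u v w = begin
    ‖ u -ᴱ w ‖                    ≤⟨ dist-triangle u v w ⟩
    ‖ u -ᴱ v ‖ + ‖ v -ᴱ w ‖       ≈⟨ +-congʳ (dist-sym u v) ⟩
    ‖ v -ᴱ u ‖ + ‖ v -ᴱ w ‖       ∎

  dist-triangleʳ : ∀ u v w → ‖ u -ᴱ w ‖ ≤ ‖ u -ᴱ v ‖ + ‖ w -ᴱ v ‖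
  dist-triangleʳ u v w = begin
    ‖ u -ᴱ w ‖                    ≤⟨ dist-triangle u v w ⟩
    ‖ u -ᴱ v ‖ + ‖ v -ᴱ w ‖       ≈⟨ +-congˡ (dist-sym v w) ⟩
    ‖ u -ᴱ v ‖ + ‖ w -ᴱ v ‖       ∎

  dist-diff : ∀ u v → ‖ u -ᴱ v ‖ ≤ ‖ u ‖ + ‖ v ‖
  dist-diff u v = ≤.trans (‖‖-triangle u (-ᴹ v)) (≤.reflexive (+-congˡ (‖-‖ v)))

  ‖‖-near : ∀ u v → ‖ u ‖ ≤ ‖ v ‖ + ‖ v -ᴱ u ‖
  ‖‖-near u v = begin
    ‖ u ‖                            ≈⟨ ‖‖-cong (u-0≈u u) ⟨
    ‖ u -ᴱ 0ᴹ ‖                      ≤⟨ dist-triangleˡ u v 0ᴹ ⟩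
    ‖ v -ᴱ u ‖ + ‖ v -ᴱ 0ᴹ ‖         ≈⟨ +-comm _ _ ⟩
    ‖ v -ᴱ 0ᴹ ‖ + ‖ v -ᴱ u ‖         ≈⟨ +-congʳ (‖‖-cong (u-0≈u v)) ⟩
    ‖ v ‖ + ‖ v -ᴱ u ‖               ∎

  ‖‖-limit-≤ : ∀ {u : ℕ → Carrierᴹ} {l b} → u ⟶ l → (∀ n → ‖ u n ‖ ≤ b) → ‖ l ‖ ≤ b
  ‖‖-limit-≤ {u} {l} {b} u⟶l u≤b = ≤-of-≤+ε λ ε 0<ε → let N , h = u⟶l ε 0<ε in begin
    ‖ l ‖                       ≤⟨ ‖‖-near l (u N) ⟩
    ‖ u N ‖ + ‖ u N -ᴱ l ‖      ≤⟨ +-mono-≤ (u≤b N) (proj₁ (h N ℕ.≤-refl)) ⟩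
    b + ε                       ∎

-- Arithmetic of [0,∞] and its passage to real numbers

module ExtendedRealProperties {ℓ} (ℝ : CompleteOrderedField ℓ) where
  open CompleteOrderedField ℝ hiding (zero)
  open ExtendedReals ℝ

  ≤⁺-refl : ∀ {x} → x ≤⁺ x
  ≤⁺-refl {[ _ ]} = [ ≤.refl ]≤
  ≤⁺-refl {∞}     = ∞ ≤⊤⁺

  ≤⁺-trans : ∀ {x y z} → x ≤⁺ y → y ≤⁺ z → x ≤⁺ z
  ≤⁺-trans = AddSupremum.≤⁺-trans _≤ℝ≥0_ ≤.trans

  0∞≤ : ∀ x → 0∞ ≤⁺ x
  0∞≤ [ _ , 0≤x ] = [ 0≤x ]≤
  0∞≤ ∞           = 0∞ ≤⊤⁺

  ≢∞-down : ∀ {x y} → x ≤⁺ y → y ≢ ∞ → x ≢ ∞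
  ≢∞-down (_ ≤⊤⁺) y≢∞ _ = y≢∞ ≡.refl

  [_]≢∞ : ∀ {x y} → x ≤⁺ [ y ] → x ≢ ∞
  [ () ]≢∞ ≡.refl

  -- toReal ∞ = 0, so most lemmas below assume finiteness.
  toReal : [0,∞] → Carrier
  toReal [ x , _ ] = x
  toReal ∞         = 0#

  toReal-nonneg : ∀ x → 0# ≤ toReal x
  toReal-nonneg [ _ , 0≤x ] = 0≤x
  toReal-nonneg ∞           = ≤.refl

  toReal-mono : ∀ {x y} → x ≤⁺ y → y ≢ ∞ → toReal x ≤ toReal y
  toReal-mono [ x≤y ]≤ _   = x≤y
  toReal-mono (_ ≤⊤⁺)  y≢∞ = ⊥-elim (y≢∞ ≡.refl)

  toReal-cong : ∀ {x y} → x ≈∞ y → toReal x ≈ toReal y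
  toReal-cong ([ p ]≤ , [ q ]≤)  = ≤.antisym p q
  toReal-cong ((_ ≤⊤⁺) , (_ ≤⊤⁺))    = refl

  ≤-toReal : ∀ {x} → x ≢ ∞ → ∀ 0≤r → x ≤⁺ [ toReal x , 0≤r ]
  ≤-toReal {[ _ ]} _   _ = [ ≤.refl ]≤
  ≤-toReal {∞}     x≢∞ _ = ⊥-elim (x≢∞ ≡.refl)

  toReal-+ : ∀ {x y} → x +∞ y ≢ ∞ → toReal (x +∞ y) ≈ toReal x + toReal y
  toReal-+ {[ _ ]} {[ _ ]} _ = refl
  toReal-+ {[ _ ]} {∞} p     = ⊥-elim (p ≡.refl)
  toReal-+ {∞} p             = ⊥-elim (p ≡.refl)

  +-≢∞ : ∀ {x y} → x ≢ ∞ → y ≢ ∞ → x +∞ y ≢ ∞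
  +-≢∞ {[ _ ]} {[ _ ]} _ _ ()
  +-≢∞ {[ _ ]} {∞} _ q     = q
  +-≢∞ {∞} p _             = p

  +∞-identityˡ : ∀ x → 0∞ +∞ x ≈∞ x
  +∞-identityˡ [ x , _ ] = [ ≤.reflexive (+-identityˡ x) ]≤ , [ ≤.reflexive (sym (+-identityˡ x)) ]≤
  +∞-identityˡ ∞         = (∞ ≤⊤⁺) , (∞ ≤⊤⁺)

  +∞-identityʳ : ∀ x → x +∞ 0∞ ≈∞ x
  +∞-identityʳ [ x , _ ] = [ ≤.reflexive (+-identityʳ x) ]≤ , [ ≤.reflexive (sym (+-identityʳ x)) ]≤
  +∞-identityʳ ∞         = (∞ ≤⊤⁺) , (∞ ≤⊤⁺)

-- Finite additivity and continuity from above of the measure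

module MeasureProperties (em : ∀ {a} → ExcludedMiddle a) {ℓ} {ℝ : CompleteOrderedField ℓ} (M : MeasureSpace ℝ) where
  open CompleteOrderedField ℝ hiding (zero)
  open OrderedField em ℝ
  open ExtendedReals ℝ
  open ExtendedRealProperties ℝ
  open MeasureSpace M
  open ≤-Reasoning

  +∞-mono : ∀ {x x′ y y′} → x ≤⁺ x′ → y ≤⁺ y′ → x +∞ y ≤⁺ x′ +∞ y′
  +∞-mono [ p ]≤ [ q ]≤                   = [ +-mono-≤ p q ]≤
  +∞-mono {x} {y = y} (_ ≤⊤⁺) _           = (x +∞ y) ≤⊤⁺
  +∞-mono {[ _ ]} {[ _ ]} {y} [ _ ]≤ (_ ≤⊤⁺) = _ ≤⊤⁺

  -- Padding with empty sets turns the axioms on countable unions into binary ones.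
  pair : Pred Point ℓ → Pred Point ℓ → ℕ → Pred Point ℓ
  pair A B zero          = A
  pair A B (suc zero)    = B
  pair A B (suc (suc _)) = ∅

  pair-measurable : ∀ {A B} → Measurable A → Measurable B → ∀ n → Measurable (pair A B n)
  pair-measurable mA mB zero          = mA
  pair-measurable mA mB (suc zero)    = mB
  pair-measurable mA mB (suc (suc _)) = empty

  ⋃-pair : ∀ {A B} → ⋃ ℕ (pair A B) ≐ A ∪ B
  ⋃-pair = (λ { (zero , p) → inj₁ p ; (suc zero , p) → inj₂ p ; (suc (suc _) , lift ()) })
         , λ { (inj₁ p) → zero , p ; (inj₂ p) → suc zero , p }

  ∪-measurable : ∀ {A B} → Measurable A → Measurable B → Measurable (A ∪ B)
  ∪-measurable mA mB = resp-≐ ⋃-pair (union (pair-measurable mA mB))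

  by-contradiction : ∀ {p} {P : Set p} → ¬ ¬ P → P
  by-contradiction {P = P} ¬¬p with em {P = P}
  ... | yes p = p
  ... | no ¬p = ⊥-elim (¬¬p ¬p)

  cases : ∀ {p c} (P : Set p) {C : Set c} → (P → C) → (¬ P → C) → C
  cases P yes-case no-case with em {P = P}
  ... | yes p = yes-case p
  ... | no ¬p = no-case ¬p

  abstract
    -- Opaque, so that the case distinction never unfolds in types and is reached only through
    -- `choose-∈` and `choose-∉`.
    choose : ∀ {b} {B : Set b} → Pred Point ℓ → B → B → Point → B
    choose A u v x = cases (x ∈ A) (λ _ → u) (λ _ → v)

    choose-∈ : ∀ {b} {B : Set b} {A} {u v : B} {x} → x ∈ A → choose A u v x ≡ u
    choose-∈ {A = A} {x = x} a with em {P = x ∈ A}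
    ... | yes _ = ≡.refl
    ... | no ¬a = ⊥-elim (¬a a)

    choose-∉ : ∀ {b} {B : Set b} {A} {u v : B} {x} → x ∉ A → choose A u v x ≡ v
    choose-∉ {A = A} {x = x} ¬a with em {P = x ∈ A}
    ... | yes a = ⊥-elim (¬a a)
    ... | no _  = ≡.refl

  choose-elim : ∀ {b p} {B : Set b} (P : B → Set p) {A} {u v : B} {x} →
                (x ∈ A → P u) → (x ∉ A → P v) → P (choose A u v x)
  choose-elim P {A} {x = x} in-case out-case = cases (x ∈ A)
    (λ a → ≡.subst P (≡.sym (choose-∈ a)) (in-case a)) (λ ¬a → ≡.subst P (≡.sym (choose-∉ ¬a)) (out-case ¬a))

  ∩-measurable : ∀ {A B} → Measurable A → Measurable B → Measurable (A ∩ B)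
  ∩-measurable mA mB = resp-≐
    ((λ h → by-contradiction (h ∘ inj₁) , by-contradiction (h ∘ inj₂)) ,
     (λ { (a , b) (inj₁ ¬a) → ¬a a ; (a , b) (inj₂ ¬b) → ¬b b }))
    (complement (∪-measurable (complement mA) (complement mB)))

  ⋂-measurable : ∀ {A : ℕ → Pred Point ℓ} → (∀ n → Measurable (A n)) → Measurable (λ x → ∀ n → A n x)
  ⋂-measurable mA = resp-≐
    ((λ h n → by-contradiction λ ¬a → h (n , ¬a)) , (λ { h (n , ¬a) → ¬a (h n) }))
    (complement (union λ n → complement (mA n)))

  constant-measurable : (P : Set ℓ) → Measurable (λ _ → P)
  constant-measurable P with em {P = P}
  ... | yes p = resp-≐ ((λ _ → p) , (λ _ → λ ())) (complement empty)
  ... | no ¬p = resp-≐ ((λ ()) , (λ p → ⊥-elim (¬p p))) empty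

  μ-∪ : ∀ {A B} (mA : Measurable A) (mB : Measurable B) (mA∪B : Measurable (A ∪ B)) →
        (∀ {x} → x ∈ A → x ∉ B) → μ (A ∪ B) mA∪B ≈∞ μ A mA +∞ μ B mB
  μ-∪ {A} {B} mA mB mA∪B A⊥B = ≤⁺-trans (proj₁ μ∪≈) (least (λ { (n , ≡.refl) → upper n }))
                             -- The partial sum of length 2 is already 0 + μ(A) + μ(B); all later
                             -- terms are μ(∅).
                             , ≤⁺-trans (≤⁺-trans (+∞-mono (proj₂ (+∞-identityˡ _)) ≤⁺-refl) (ub (2 , ≡.refl))) (proj₂ μ∪≈)
    where
    disjoint : ∀ {m n} → m ≢ n → pair A B m Disjoint pair A B n
    disjoint {zero}        {zero}        m≢n _       = m≢n ≡.refl
    disjoint {zero}        {suc zero}    _   (a , b) = A⊥B a b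
    disjoint {suc zero}    {zero}        _   (b , a) = A⊥B a b
    disjoint {suc zero}    {suc zero}    m≢n _       = m≢n ≡.refl
    disjoint {suc (suc _)} {_}           _   (lift () , _)
    disjoint {zero}        {suc (suc _)} _   (_ , lift ())
    disjoint {suc zero}    {suc (suc _)} _   (_ , lift ())
    series = μ-⋃ (pair-measurable mA mB) disjoint
    ub     = proj₁ series
    least  = proj₂ series
    μ∪≈ : μ (A ∪ B) mA∪B ≈∞ μ (⋃ ℕ (pair A B)) (union (pair-measurable mA mB))
    μ∪≈ = μ-cong mA∪B _ (proj₂ ⋃-pair , proj₁ ⋃-pair)
    x = λ n → μ (pair A B n) (pair-measurable mA mB n)
    upper : ∀ n → partialSum x n ≤⁺ μ A mA +∞ μ B mB
    upper zero                = 0∞≤ _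
    upper (suc zero)          = ≤⁺-trans (proj₁ (+∞-identityˡ _)) (≤⁺-trans (proj₂ (+∞-identityʳ _)) (+∞-mono ≤⁺-refl (0∞≤ _)))
    upper (suc (suc zero))    = +∞-mono (proj₁ (+∞-identityˡ _)) ≤⁺-refl
    upper (suc (suc (suc n))) = ≤⁺-trans (+∞-mono (upper (suc (suc n))) (proj₁ μ-∅)) (proj₁ (+∞-identityʳ _))

  MeasurableSet : Set (lsuc ℓ)
  MeasurableSet = ∃ Measurable

  ∁ᵐ : MeasurableSet → MeasurableSet
  ∁ᵐ (A , mA) = ∁ A , complement mA

  _∩ᵐ_ : MeasurableSet → MeasurableSet → MeasurableSet
  (A , mA) ∩ᵐ (B , mB) = A ∩ B , ∩-measurable mA mB

  fullᵐ : MeasurableSet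
  fullᵐ = ∁ ∅ , complement empty

  measure : MeasurableSet → [0,∞]
  measure (A , mA) = μ A mA

  measure-split : ∀ A B → measure A ≈∞ measure (A ∩ᵐ B) +∞ measure (A ∩ᵐ ∁ᵐ B)
  measure-split (A , mA) (B , mB) = ≤⁺-trans (proj₁ e₁) (proj₁ e₂) , ≤⁺-trans (proj₂ e₂) (proj₂ e₁)
    where
    m₁ = ∩-measurable mA mB
    m₂ = ∩-measurable mA (complement mB)
    A≐ : A ≐ (A ∩ B) ∪ (A ∩ ∁ B)
    A≐ = to , (λ { (inj₁ p) → proj₁ p ; (inj₂ p) → proj₁ p })
      where
      to : A ⊆ (A ∩ B) ∪ (A ∩ ∁ B)
      to {x} a with em {P = B x}
      ... | yes b = inj₁ (a , b)
      ... | no ¬b = inj₂ (a , ¬b)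
    e₁ = μ-cong mA (∪-measurable m₁ m₂) A≐
    e₂ = μ-∪ m₁ m₂ (∪-measurable m₁ m₂) (λ p q → proj₂ q (proj₂ p))

  measure-mono : ∀ A B → proj₁ A ⊆ proj₁ B → measure A ≤⁺ measure B
  measure-mono A B A⊆B = ≤⁺-trans (proj₁ (μ-cong _ _ ((λ a → A⊆B a , a) , proj₂)))
    (≤⁺-trans (≤⁺-trans (proj₂ (+∞-identityʳ _)) (+∞-mono ≤⁺-refl (0∞≤ _))) (proj₂ (measure-split B A)))

  measure-empty : ∀ A → (∀ {x} → x ∉ proj₁ A) → measure A ≤⁺ 0∞
  measure-empty A ∄x = ≤⁺-trans (measure-mono A (∅ , empty) (λ a → ⊥-elim (∄x a))) (proj₁ μ-∅)

  record FiniteSet : Set (lsuc ℓ) where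
    constructor finite
    field
      underlying : MeasurableSet
      isFinite   : measure underlying ≢ ∞

    set : Pred Point ℓ
    set = proj₁ underlying

    volume : Carrier
    volume = toReal (measure underlying)

  open FiniteSet public

  infixl 7 _∩ᶠ_
  _∩ᶠ_ : FiniteSet → MeasurableSet → FiniteSet
  finite A A<∞ ∩ᶠ B = finite (A ∩ᵐ B) (≢∞-down (measure-mono (A ∩ᵐ B) A proj₁) A<∞)

  volume-nonneg : ∀ A → 0# ≤ volume A
  volume-nonneg A = toReal-nonneg (measure (underlying A))

  volume-mono : ∀ A B → set A ⊆ set B → volume A ≤ volume B
  volume-mono A B A⊆B = toReal-mono (measure-mono (underlying A) (underlying B) A⊆B) (isFinite B)

  volume-cong : ∀ A B → set A ≐ set B → volume A ≈ volume B
  volume-cong A B (A⊆B , B⊆A) = ≤.antisym (volume-mono A B A⊆B) (volume-mono B A B⊆A)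

  volume-empty : ∀ A → (∀ {x} → x ∉ set A) → volume A ≈ 0#
  volume-empty A ∄x = ≤.antisym (toReal-mono (measure-empty (underlying A) ∄x) λ ()) (volume-nonneg A)

  volume-split : ∀ A B → volume A ≈ volume (A ∩ᶠ B) + volume (A ∩ᶠ ∁ᵐ B)
  volume-split A B = trans (toReal-cong split) (toReal-+ (≢∞-down (proj₂ split) (isFinite A)))
    where split = measure-split (underlying A) B

  module _ (A : FiniteSet) (B : ℕ → MeasurableSet)
           (antitone : ∀ {m n} → m ℕ.≤ n → proj₁ (B n) ⊆ proj₁ (B m))
           (vanishing : ∀ {x} → ¬ (∀ n → x ∈ proj₁ (B n))) where

    private
      shell : ℕ → MeasurableSet
      shell n = (underlying A ∩ᵐ B n) ∩ᵐ ∁ᵐ (B (suc n))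

      shells-disjoint : ∀ {m n} → m ≢ n → proj₁ (shell m) Disjoint proj₁ (shell n)
      shells-disjoint {m} {n} m≢n (((_ , bm) , ¬bm) , ((_ , bn) , ¬bn)) with ℕ.<-cmp m n
      ... | tri< m<n _ _ = ¬bm (antitone m<n bn)
      ... | tri≈ _ m≡n _ = m≢n m≡n
      ... | tri> _ _ n<m = ¬bn (antitone n<m bm)

      -- A downward search from a set that misses `x`; it locates the shell containing `x`.
      last-index : ∀ {x} n → x ∈ proj₁ (B 0) → x ∉ proj₁ (B n) → ∃[ k ] (x ∈ proj₁ (B k) × x ∉ proj₁ (B (suc k)))
      last-index zero    b ¬b = ⊥-elim (¬b b)
      last-index {x} (suc n) b ¬b with em {P = x ∈ proj₁ (B n)}
      ... | yes bn = n , bn , ¬b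
      ... | no ¬bn = last-index n b ¬bn

      x : ℕ → [0,∞]
      x n = measure (shell n)

      V : ℕ → Carrier
      V n = volume (A ∩ᶠ B n)

      partial≢∞ : ∀ n → partialSum x n ≢ ∞
      partial≢∞ zero    ()
      partial≢∞ (suc n) = +-≢∞ (partial≢∞ n) (isFinite (A ∩ᶠ B n ∩ᶠ ∁ᵐ (B (suc n))))

      -- The first n shells and the remainder A ∩ B n exhaust A ∩ B 0. Writing this as a sum keeps
      -- subtraction out of the induction.
      telescope : ∀ n → toReal (partialSum x n) + V n ≈ V 0
      telescope zero    = +-identityˡ (V 0)
      telescope (suc n) = begin-equality
        toReal (partialSum x n +∞ x n) + V (suc n)                  ≈⟨ +-congʳ (toReal-+ {partialSum x n} {x n} (partial≢∞ (suc n))) ⟩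
        toReal (partialSum x n) + volume shellᶠ + V (suc n)         ≈⟨ +-assoc _ _ _ ⟩
        toReal (partialSum x n) + (volume shellᶠ + V (suc n))       ≈⟨ +-congˡ (+-comm _ _) ⟩
        toReal (partialSum x n) + (V (suc n) + volume shellᶠ)       ≈⟨ +-congˡ (+-congʳ (volume-cong (A ∩ᶠ B (suc n)) (A ∩ᶠ B n ∩ᶠ B (suc n)) inner≐)) ⟩
        toReal (partialSum x n) + (volume (A ∩ᶠ B n ∩ᶠ B (suc n)) + volume shellᶠ)
                                                                    ≈⟨ +-congˡ (volume-split (A ∩ᶠ B n) (B (suc n))) ⟨
        toReal (partialSum x n) + V n                               ≈⟨ telescope n ⟩
        V 0                                                         ∎
        where
        shellᶠ = A ∩ᶠ B n ∩ᶠ ∁ᵐ (B (suc n))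
        inner≐ : set (A ∩ᶠ B (suc n)) ≐ set (A ∩ᶠ B n ∩ᶠ B (suc n))
        inner≐ = (λ { (a , b) → (a , antitone (ℕ.n≤1+n n) b) , b }) , (λ { ((a , _) , b) → a , b })

    -- The shells A ∩ (B n ∖ B (n+1)) partition A ∩ B 0, so the volume of A ∩ B n is
    -- the tail of a convergent series.
    volume-continuous : ∀ {ε} → 0# < ε → ∃[ N ] ∀ n → N ℕ.≤ n → volume (A ∩ᶠ B n) ≤ ε
    volume-continuous {ε} 0<ε with em {P = ∃[ N ] V N ≤ ε}
    ... | yes (N , VN≤ε) = N , λ n N≤n →
      ≤.trans (volume-mono (A ∩ᶠ B n) (A ∩ᶠ B N) (λ { (a , b) → a , antitone N≤n b })) VN≤ε
    -- If every remainder exceeded ε, all partial sums of shell volumes would be at most V 0 - ε,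
    -- and so would their supremum, which is V 0.
    ... | no ¬small = ⊥-elim (<⇒≱ (x<x+y 0<ε) (begin
        V 0 + ε              ≤⟨ +-mono-≤ V0≤ ≤.refl ⟩
        (V 0 - ε) + ε        ≈⟨ +-comm _ _ ⟩
        ε + (V 0 - ε)        ≈⟨ x+[y-x]≈y ε (V 0) ⟩
        V 0                  ∎))
      where
      ε<V : ∀ n → ε < V n
      ε<V n = ≰⇒> λ p → ¬small (n , p)
      bound : ∀ n → toReal (partialSum x n) ≤ V 0 - ε
      bound n = +-cancelʳ-≤ ε (begin
        toReal (partialSum x n) + ε      ≤⟨ +-monoʳ-≤ _ (proj₁ (ε<V n)) ⟩
        toReal (partialSum x n) + V n    ≈⟨ telescope n ⟩
        V 0                              ≈⟨ x+[y-x]≈y ε (V 0) ⟨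
        ε + (V 0 - ε)                    ≈⟨ +-comm _ _ ⟩
        (V 0 - ε) + ε                    ∎)
      0≤bound : 0# ≤ V 0 - ε
      0≤bound = x≤y⇒0≤y-x (proj₁ (ε<V 0))
      shells≐ : set (A ∩ᶠ B 0) ≐ ⋃ ℕ (λ n → proj₁ (shell n))
      shells≐ = to , (λ { (n , ((a , b) , _)) → a , antitone ℕ.z≤n b })
        where
        to : set (A ∩ᶠ B 0) ⊆ ⋃ ℕ (λ n → proj₁ (shell n))
        to {y} (a , b) with em {P = ∃[ n ] y ∉ proj₁ (B n)}
        ... | no ¬∃        = ⊥-elim (vanishing λ n → by-contradiction λ ¬b → ¬∃ (n , ¬b))
        ... | yes (n , ¬b) with last-index n b ¬b
        ... | k , bk , ¬bk = k , ((a , bk) , ¬bk)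
      series = μ-⋃ (λ n → proj₂ (shell n)) shells-disjoint
      bounded : μ (⋃ ℕ (λ n → proj₁ (shell n))) _ ≤⁺ [ V 0 - ε , 0≤bound ]
      bounded = proj₂ series λ { (n , ≡.refl) → ≤⁺-trans (≤-toReal (partial≢∞ n) (toReal-nonneg (partialSum x n))) [ bound n ]≤ }
      V0≤ : V 0 ≤ V 0 - ε
      V0≤ = toReal-mono (≤⁺-trans (proj₁ (μ-cong _ _ shells≐)) bounded) λ ()

-- Module-valued step functions and the cone principle

module Steps (em : ∀ {a} → ExcludedMiddle a) {ℓ} {ℝ : CompleteOrderedField ℓ} (M : MeasureSpace ℝ)
             (V : LeftModule (CompleteOrderedField.ring ℝ) ℓ ℓ) where
  open CompleteOrderedField ℝ hiding (zero)
  open ExtendedReals ℝ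
  open ExtendedRealProperties ℝ
  open MeasureSpace M
  open MeasureProperties em M
  open LeftModule V
  open SetoidReasoning ≈ᴹ-setoid

  -- The sets of a step function may overlap, so that addition is concatenation.
  Step : Set (lsuc ℓ)
  Step = List (FiniteSet × Carrierᴹ)

  indicator : Pred Point ℓ → Carrierᴹ → Point → Carrierᴹ
  indicator A v = choose A v 0ᴹ

  indicator-∈ : ∀ {A v x} → x ∈ A → indicator A v x ≈ᴹ v
  indicator-∈ a = ≈ᴹ-reflexive (choose-∈ a)

  indicator-∉ : ∀ {A v x} → x ∉ A → indicator A v x ≈ᴹ 0ᴹ
  indicator-∉ ¬a = ≈ᴹ-reflexive (choose-∉ ¬a)

  ⟦_⟧ : Step → Point → Carrierᴹ
  ⟦ [] ⟧          x = 0ᴹ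
  ⟦ (A , v) ∷ L ⟧ x = indicator (set A) v x +ᴹ ⟦ L ⟧ x

  -- Localised to `C` so that the space can be cut along sets. `C` may have infinite measure,
  -- because only its traces on the sets of the list are measured.
  integralOver : MeasurableSet → Step → Carrierᴹ
  integralOver C []            = 0ᴹ
  integralOver C ((A , v) ∷ L) = volume (A ∩ᶠ C) *ₗ v +ᴹ integralOver C L

  integral : Step → Carrierᴹ
  integral []            = 0ᴹ
  integral ((A , v) ∷ L) = volume A *ₗ v +ᴹ integral L

  integralOver-full : ∀ L → integralOver fullᵐ L ≈ᴹ integral L
  integralOver-full []            = ≈ᴹ-refl
  integralOver-full ((A , v) ∷ L) = +ᴹ-cong
    (*ₗ-congʳ (volume-cong (A ∩ᶠ fullᵐ) A (proj₁ , (λ a → a , λ ())))) (integralOver-full L)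

  interchange : ∀ a b c d → (a +ᴹ b) +ᴹ (c +ᴹ d) ≈ᴹ (a +ᴹ c) +ᴹ (b +ᴹ d)
  interchange = solve 4 (λ a b c d → (a ⊕ b) ⊕ (c ⊕ d) ⊜ (a ⊕ c) ⊕ (b ⊕ d)) ≈ᴹ-refl
    where open CommutativeMonoidSolver +ᴹ-commutativeMonoid

  volume-∩-split : ∀ A C B → volume (A ∩ᶠ C) ≈ volume (A ∩ᶠ (C ∩ᵐ B)) + volume (A ∩ᶠ (C ∩ᵐ ∁ᵐ B))
  volume-∩-split A C B = trans (volume-split (A ∩ᶠ C) B) (+-cong
    (volume-cong (A ∩ᶠ C ∩ᶠ B) (A ∩ᶠ (C ∩ᵐ B)) ((λ { ((a , c) , b) → a , c , b }) , (λ { (a , c , b) → (a , c) , b })))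
    (volume-cong (A ∩ᶠ C ∩ᶠ ∁ᵐ B) (A ∩ᶠ (C ∩ᵐ ∁ᵐ B)) ((λ { ((a , c) , b) → a , c , b }) , (λ { (a , c , b) → (a , c) , b }))))

  integralOver-split : ∀ C B L → integralOver C L ≈ᴹ integralOver (C ∩ᵐ B) L +ᴹ integralOver (C ∩ᵐ ∁ᵐ B) L
  integralOver-split C B []            = ≈ᴹ-sym (+ᴹ-identityˡ 0ᴹ)
  integralOver-split C B ((A , v) ∷ L) = ≈ᴹ-trans
    (+ᴹ-cong (≈ᴹ-trans (*ₗ-congʳ (volume-∩-split A C B)) (*ₗ-distribʳ v _ _)) (integralOver-split C B L))
    (interchange _ _ _ _)

  -- Splitting the space along the first set of the list makes that summand constant
  -- on each half; once all summands are constant, the integral is volume times value.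
  module _ {p} (K : Pred Carrierᴹ p) (K-resp : ∀ {u v} → u ≈ᴹ v → u ∈ K → v ∈ K) (K-0 : 0ᴹ ∈ K)
           (K-+ : ∀ {u v} → u ∈ K → v ∈ K → (u +ᴹ v) ∈ K) (K-* : ∀ {c v} → 0# ≤ c → v ∈ K → (c *ₗ v) ∈ K) where

    private
      first-on : ∀ A v L {x} → x ∈ set A → ⟦ (A , v) ∷ L ⟧ x ≈ᴹ v +ᴹ ⟦ L ⟧ x
      first-on A v L a = +ᴹ-congʳ (indicator-∈ a)

      first-off : ∀ A v L {x} → x ∉ set A → ⟦ (A , v) ∷ L ⟧ x ≈ᴹ ⟦ L ⟧ x
      first-off A v L ¬a = ≈ᴹ-trans (+ᴹ-congʳ (indicator-∉ ¬a)) (+ᴹ-identityˡ _)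

    -- `c` collects the values of the summands already made constant on `C`; on one half the next
    -- value joins it, on the other that summand vanishes.
    cone-finite : ∀ (C : FiniteSet) c L → (∀ {x} → x ∈ set C → (c +ᴹ ⟦ L ⟧ x) ∈ K) →
                  (volume C *ₗ c +ᴹ integralOver (underlying C) L) ∈ K
    cone-finite C c [] h with em {P = ∃[ x ] x ∈ set C}
    ... | yes (x , x∈C) = K-resp (≈ᴹ-sym (+ᴹ-identityʳ _))
                            (K-* (volume-nonneg C) (K-resp (+ᴹ-identityʳ c) (h x∈C)))
    -- On an empty `C` nothing is known about `c`, but the volume is 0 and so is the whole
    -- expression.
    ... | no ∄x         = K-resp (≈ᴹ-sym (≈ᴹ-trans (+ᴹ-identityʳ _)
                            (≈ᴹ-trans (*ₗ-congʳ (volume-empty C (λ c → ∄x (_ , c)))) (*ₗ-zeroˡ c)))) K-0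
    cone-finite C c ((A , v) ∷ L) h = K-resp eq (K-+
      (cone-finite C₁ (c +ᴹ v) L (λ { (x∈C , a) → K-resp (≈ᴹ-trans (+ᴹ-congˡ (first-on A v L a)) (≈ᴹ-sym (+ᴹ-assoc c v _))) (h x∈C) }))
      (cone-finite C₂ c L (λ { (x∈C , ¬a) → K-resp (+ᴹ-congˡ (first-off A v L ¬a)) (h x∈C) })))
      where
      C₁ = C ∩ᶠ underlying A
      C₂ = C ∩ᶠ ∁ᵐ (underlying A)
      I₁ = integralOver (underlying C₁) L
      I₂ = integralOver (underlying C₂) L
      A∩C = A ∩ᶠ underlying C
      rearrange : ∀ p q r s t → ((p +ᴹ q) +ᴹ r) +ᴹ (s +ᴹ t) ≈ᴹ (p +ᴹ s) +ᴹ (q +ᴹ (r +ᴹ t))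
      rearrange = solve 5 (λ p q r s t → ((p ⊕ q) ⊕ r) ⊕ (s ⊕ t) ⊜ (p ⊕ s) ⊕ (q ⊕ (r ⊕ t))) ≈ᴹ-refl
        where open CommutativeMonoidSolver +ᴹ-commutativeMonoid
      eq : (volume C₁ *ₗ (c +ᴹ v) +ᴹ I₁) +ᴹ (volume C₂ *ₗ c +ᴹ I₂) ≈ᴹ
           volume C *ₗ c +ᴹ (volume A∩C *ₗ v +ᴹ integralOver (underlying C) L)
      eq = begin
        (volume C₁ *ₗ (c +ᴹ v) +ᴹ I₁) +ᴹ (volume C₂ *ₗ c +ᴹ I₂)
          ≈⟨ +ᴹ-congʳ (+ᴹ-congʳ (*ₗ-distribˡ (volume C₁) c v)) ⟩
        ((volume C₁ *ₗ c +ᴹ volume C₁ *ₗ v) +ᴹ I₁) +ᴹ (volume C₂ *ₗ c +ᴹ I₂)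
          ≈⟨ rearrange _ _ _ _ _ ⟩
        (volume C₁ *ₗ c +ᴹ volume C₂ *ₗ c) +ᴹ (volume C₁ *ₗ v +ᴹ (I₁ +ᴹ I₂))
          ≈⟨ +ᴹ-cong (*ₗ-distribʳ c _ _) (+ᴹ-congˡ (integralOver-split (underlying C) (underlying A) L)) ⟨
        (volume C₁ + volume C₂) *ₗ c +ᴹ (volume C₁ *ₗ v +ᴹ integralOver (underlying C) L)
          ≈⟨ +ᴹ-cong (*ₗ-congʳ (volume-split C (underlying A)))
                     (+ᴹ-congʳ (*ₗ-congʳ (volume-cong A∩C C₁ ((λ { (a , b) → b , a }) , (λ { (b , a) → a , b }))))) ⟨
        volume C *ₗ c +ᴹ (volume A∩C *ₗ v +ᴹ integralOver (underlying C) L) ∎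

    cone-over : ∀ C L → (∀ {x} → x ∈ proj₁ C → ⟦ L ⟧ x ∈ K) → integralOver C L ∈ K
    cone-over C []            h = K-0
    cone-over C ((A , v) ∷ L) h = K-resp eq (K-+
      (cone-finite C₁ v L (λ { (a , x∈C) → K-resp (first-on A v L a) (h x∈C) }))
      (cone-over C₂ L (λ { (x∈C , ¬a) → K-resp (first-off A v L ¬a) (h x∈C) })))
      where
      C₁ = A ∩ᶠ C
      C₂ = C ∩ᵐ ∁ᵐ (underlying A)
      over-cong : ∀ B B′ L → proj₁ B ≐ proj₁ B′ → integralOver B L ≈ᴹ integralOver B′ L
      over-cong B B′ []            e = ≈ᴹ-refl
      over-cong B B′ ((A , v) ∷ L) e = +ᴹ-cong (*ₗ-congʳ (volume-cong (A ∩ᶠ B) (A ∩ᶠ B′)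
        ((λ { (a , b) → a , proj₁ e b }) , (λ { (a , b) → a , proj₂ e b })))) (over-cong B B′ L e)
      eq : (volume C₁ *ₗ v +ᴹ integralOver (underlying C₁) L) +ᴹ integralOver C₂ L ≈ᴹ
           volume C₁ *ₗ v +ᴹ integralOver C L
      eq = ≈ᴹ-trans (+ᴹ-assoc _ _ _) (+ᴹ-congˡ (≈ᴹ-trans
        (+ᴹ-congʳ (over-cong (underlying C₁) (C ∩ᵐ underlying A) L ((λ { (a , b) → b , a }) , (λ { (b , a) → a , b }))))
        (≈ᴹ-sym (integralOver-split C (underlying A) L))))

    integral-cone : ∀ L → (∀ x → ⟦ L ⟧ x ∈ K) → integral L ∈ K
    integral-cone L h = K-resp (integralOver-full L) (cone-over fullᵐ L (λ {x} _ → h x))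

  ⟦++⟧ : ∀ L L′ x → ⟦ L ++ L′ ⟧ x ≈ᴹ ⟦ L ⟧ x +ᴹ ⟦ L′ ⟧ x
  ⟦++⟧ []            L′ x = ≈ᴹ-sym (+ᴹ-identityˡ _)
  ⟦++⟧ ((A , v) ∷ L) L′ x = ≈ᴹ-trans (+ᴹ-congˡ (⟦++⟧ L L′ x)) (≈ᴹ-sym (+ᴹ-assoc _ _ _))

  integral-++ : ∀ L L′ → integral (L ++ L′) ≈ᴹ integral L +ᴹ integral L′
  integral-++ []            L′ = ≈ᴹ-sym (+ᴹ-identityˡ _)
  integral-++ ((A , v) ∷ L) L′ = ≈ᴹ-trans (+ᴹ-congˡ (integral-++ L L′)) (≈ᴹ-sym (+ᴹ-assoc _ _ _))

  Covered : Step → Pred Point (lsuc ℓ)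
  Covered L x = Any (λ (A , _) → x ∈ set A) L

  uncovered : ∀ L {x} → x ∉ Covered L → ⟦ L ⟧ x ≈ᴹ 0ᴹ
  uncovered []            _  = ≈ᴹ-refl
  uncovered ((A , v) ∷ L) ¬c = ≈ᴹ-trans (+ᴹ-cong (indicator-∉ (λ a → ¬c (here a))) (uncovered L (λ c → ¬c (there c)))) (+ᴹ-identityˡ 0ᴹ)

  covered-finite : ∀ L C → proj₁ C ⊆ Covered L → measure C ≢ ∞
  covered-finite []            C C⊆ = [ measure-empty C (λ c → case-[] (C⊆ c)) ]≢∞
    where
    case-[] : ∀ {x} → ¬ Covered [] x
    case-[] ()
  covered-finite ((A , v) ∷ L) C C⊆ = ≢∞-down (proj₁ (measure-split C (underlying A)))
    (+-≢∞ (≢∞-down (measure-mono (C ∩ᵐ underlying A) (underlying A) proj₂) (isFinite A))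
          (covered-finite L (C ∩ᵐ ∁ᵐ (underlying A)) λ { (c , ¬a) → tail (C⊆ c) ¬a }))
    where
    tail : ∀ {x} → Covered ((A , v) ∷ L) x → x ∉ set A → Covered L x
    tail (here a)  ¬a = ⊥-elim (¬a a)
    tail (there c) _  = c

  -- A step function vanishes outside its finitely many sets of finite measure. Dominated simple
  -- functions obtain their finite fibres from this.
  nonzero-finite : ∀ L C → (∀ {x} → x ∈ proj₁ C → ⟦ L ⟧ x ≉ᴹ 0ᴹ) → measure C ≢ ∞
  nonzero-finite L C h = covered-finite L C λ c → by-contradiction λ ¬c → h c (uncovered L ¬c)

-- Step functions under linear maps

module StepMap (em : ∀ {a} → ExcludedMiddle a) {ℓ} {ℝ : CompleteOrderedField ℓ} (M : MeasureSpace ℝ)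
               (V W : LeftModule (CompleteOrderedField.ring ℝ) ℓ ℓ) where
  open MeasureProperties em M
  private
    module V = LeftModule V
    module W = LeftModule W
    module SV = Steps em M V
    module SW = Steps em M W

  mapStep : (V.Carrierᴹ → W.Carrierᴹ) → SV.Step → SW.Step
  mapStep f = map λ (A , v) → A , f v

  module _ (f : V.Carrierᴹ → W.Carrierᴹ) (f-0 : f V.0ᴹ W.≈ᴹ W.0ᴹ)
           (f-+ : ∀ u v → f (u V.+ᴹ v) W.≈ᴹ f u W.+ᴹ f v) (f-* : ∀ c v → f (c V.*ₗ v) W.≈ᴹ c W.*ₗ f v) where

    mapStep-⟦⟧ : ∀ L x → SW.⟦ mapStep f L ⟧ x W.≈ᴹ f (SV.⟦ L ⟧ x)
    mapStep-⟦⟧ []            x = W.≈ᴹ-sym f-0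
    mapStep-⟦⟧ ((A , v) ∷ L) x = W.≈ᴹ-trans (W.+ᴹ-cong head (mapStep-⟦⟧ L x)) (W.≈ᴹ-sym (f-+ _ _))
      where
      head : SW.indicator (set A) (f v) x W.≈ᴹ f (SV.indicator (set A) v x)
      head = cases (x ∈ set A)
        (λ a → W.≈ᴹ-trans (SW.indicator-∈ a) (W.≈ᴹ-reflexive (≡.sym (≡.cong f (choose-∈ a)))))
        (λ ¬a → W.≈ᴹ-trans (SW.indicator-∉ ¬a) (W.≈ᴹ-trans (W.≈ᴹ-sym f-0) (W.≈ᴹ-reflexive (≡.sym (≡.cong f (choose-∉ ¬a))))))

    mapStep-integral : ∀ L → SW.integral (mapStep f L) W.≈ᴹ f (SV.integral L)
    mapStep-integral []            = W.≈ᴹ-sym f-0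
    mapStep-integral ((A , v) ∷ L) = W.≈ᴹ-trans (W.+ᴹ-cong (W.≈ᴹ-sym (f-* _ _)) (mapStep-integral L)) (W.≈ᴹ-sym (f-+ _ _))

-- Positivity and monotonicity for real step functions

module RealSteps (em : ∀ {a} → ExcludedMiddle a) {ℓ} {ℝ : CompleteOrderedField ℓ} (M : MeasureSpace ℝ) where
  open CompleteOrderedField ℝ hiding (zero)
  open OrderedField em ℝ
  open AbelianGroupProperties +-abelianGroup using (ε⁻¹≈ε; ⁻¹-∙-comm)
  ℝᴹ : LeftModule ring ℓ ℓ
  ℝᴹ = TensorUnit.leftModule
  open Steps em M ℝᴹ public
  open StepMap em M ℝᴹ ℝᴹ

  integral-nonneg : ∀ L → (∀ x → 0# ≤ ⟦ L ⟧ x) → 0# ≤ integral L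
  integral-nonneg = integral-cone (0# ≤_) (λ e p → ≤.trans p (≤.reflexive e)) ≤.refl 0≤+ *-nonneg

  negate : Step → Step
  negate = mapStep (λ v → - v)

  ⟦negate⟧ : ∀ L x → ⟦ negate L ⟧ x ≈ - ⟦ L ⟧ x
  ⟦negate⟧ = mapStep-⟦⟧ (λ v → - v) ε⁻¹≈ε (λ u v → sym (⁻¹-∙-comm u v)) (λ c v → -‿distribʳ-* c v)

  integral-negate : ∀ L → integral (negate L) ≈ - integral L
  integral-negate = mapStep-integral (λ v → - v) ε⁻¹≈ε (λ u v → sym (⁻¹-∙-comm u v)) (λ c v → -‿distribʳ-* c v)

  integral-mono : ∀ L L′ → (∀ x → ⟦ L ⟧ x ≤ ⟦ L′ ⟧ x) → integral L ≤ integral L′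
  integral-mono L L′ L≤L′ = 0≤y-x⇒x≤y (≤.trans (integral-nonneg (L′ ++ negate L) λ x →
      ≤.trans (x≤y⇒0≤y-x (L≤L′ x)) (≤.reflexive (sym (trans (⟦++⟧ L′ (negate L) x) (+-congˡ (⟦negate⟧ L x))))))
    (≤.reflexive (trans (integral-++ L′ (negate L)) (+-congˡ (integral-negate L)))))

-- The norm inequality for integrals of step functions

module NormedSteps (em : ∀ {a} → ExcludedMiddle a) {ℓ} {ℝ : CompleteOrderedField ℓ} (M : MeasureSpace ℝ)
                   (E : BanachSpace ℝ) where
  open CompleteOrderedField ℝ hiding (zero)
  open OrderedField em ℝ
  open BanachSpace E
  open Norm em ℝ E
  open RealSteps em M using (ℝᴹ)
  module ℝ-Steps = RealSteps em M
  module E-Steps = Steps em M leftModule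
  E×ℝ : LeftModule ring ℓ ℓ
  E×ℝ = DirectProduct.leftModule leftModule ℝᴹ
  open LeftModule E×ℝ using () renaming (Carrierᴹ to V; _≈ᴹ_ to _≈ⱽ_; _+ᴹ_ to _+ⱽ_; ≈ᴹ-sym to ≈ⱽ-sym; ≈ᴹ-trans to ≈ⱽ-trans; +ᴹ-cong to +ⱽ-cong)
  open Steps em M E×ℝ
  private
    module InE = StepMap em M leftModule E×ℝ
    module Inℝ = StepMap em M ℝᴹ E×ℝ

    inE : Carrierᴹ → V
    inE v = v , 0#

    inℝ : Carrier → V
    inℝ b = 0ᴹ , b

    inE-+ : ∀ u v → inE (u +ᴹ v) ≈ⱽ inE u +ⱽ inE v
    inE-+ u v = ≈ᴹ-refl , sym (+-identityʳ 0#)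

    inE-* : ∀ c v → inE (c *ₗ v) ≈ⱽ (c *ₗ v , c * 0#)
    inE-* c v = ≈ᴹ-refl , sym (zeroʳ c)

    inℝ-+ : ∀ u v → inℝ (u + v) ≈ⱽ inℝ u +ⱽ inℝ v
    inℝ-+ u v = ≈ᴹ-sym (+ᴹ-identityʳ 0ᴹ) , refl

    inℝ-* : ∀ c v → inℝ (c * v) ≈ⱽ (c *ₗ 0ᴹ , c * v)
    inℝ-* c v = ≈ᴹ-sym (*ₗ-zeroʳ c) , refl

    recombine : ∀ {u v a b} → u ≈ⱽ inE a → v ≈ⱽ inℝ b → u +ⱽ v ≈ⱽ (a , b)
    recombine p q = ≈ⱽ-trans (+ⱽ-cong p q) (+ᴹ-identityʳ _ , +-identityˡ _)

  -- Embedding both lists into E × ℝ and concatenating them gives one step function with values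
  -- (`⟦ L ⟧ x` , `⟦ R ⟧ x`), without a common refinement. `Below` is a cone by the triangle
  -- inequality and homogeneity.
  ‖integral‖-≤ : ∀ L R → (∀ x → ‖ E-Steps.⟦ L ⟧ x ‖ ≤ ℝ-Steps.⟦ R ⟧ x) → ‖ E-Steps.integral L ‖ ≤ ℝ-Steps.integral R
  ‖integral‖-≤ L R h = resp (≈ⱽ-trans (integral-++ L′ R′)
      (recombine (InE.mapStep-integral inE (≈ᴹ-refl , refl) inE-+ inE-* L) (Inℝ.mapStep-integral inℝ (≈ᴹ-refl , refl) inℝ-+ inℝ-* R)))
    (integral-cone Below resp (≤.reflexive (‖‖-zero ≈ᴹ-refl))
      (λ p q → ≤.trans (‖‖-triangle _ _) (+-mono-≤ p q))
      (λ {_} {v} 0≤c p → ≤.trans (≤.reflexive (‖‖-scale (proj₁ v) 0≤c)) (*-monoˡ-≤ 0≤c p))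
      (L′ ++ R′) λ x → resp (≈ⱽ-sym (≈ⱽ-trans (⟦++⟧ L′ R′ x)
        (recombine (InE.mapStep-⟦⟧ inE (≈ᴹ-refl , refl) inE-+ inE-* L x) (Inℝ.mapStep-⟦⟧ inℝ (≈ᴹ-refl , refl) inℝ-+ inℝ-* R x)))) (h x))
    where
    L′ = InE.mapStep inE L
    R′ = Inℝ.mapStep inℝ R
    Below : V → Set ℓ
    Below (v , b) = ‖ v ‖ ≤ b
    resp : ∀ {u v} → u ≈ⱽ v → Below u → Below v
    resp (p , q) h = ≤.trans (≤.reflexive (‖‖-cong (≈ᴹ-sym p))) (≤.trans h (≤.reflexive q))

-- Simple functions and their conversion into step functions

module SimpleFunctions (em : ∀ {a} → ExcludedMiddle a) {ℓ} {ℝ : CompleteOrderedField ℓ} (M : MeasureSpace ℝ) where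
  open MeasureSpace M
  open MeasureProperties em M

  Simple : (S : Setoid ℓ ℓ) → (Point → Setoid.Carrier S) → Set (lsuc ℓ)
  Simple = IsSimple sigmaAlgebra

  module _ (S : Setoid ℓ ℓ) where
    open Setoid S
    open Membership S using () renaming (_∈_ to _∈ₗ_)

    -- Excluded middle decides equality in `S`, so any list covering the range can be freed of
    -- duplicates.
    finite-range⇒simple : ∀ {s} vs → (∀ x → s x ∈ₗ vs) → (∀ v → Measurable (λ x → s x ≈ v)) → Simple S s
    finite-range⇒simple vs range fibre = record
      { values = deduplicate _≟_ vs
      ; unique = UniqueProperties.deduplicate-! decSetoid vs
      ; range  = λ x → MembershipProperties.∈-deduplicate⁺ S _≟_ (λ z≈y x≈y → trans x≈y (sym z≈y)) (range x)
      ; fibre  = fibre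
      }
      where
      _≟_ : ∀ x y → _
      x ≟ y = em {P = x ≈ y}
      decSetoid : DecSetoid ℓ ℓ
      decSetoid = record { isDecEquivalence = record { isEquivalence = isEquivalence ; _≟_ = _≟_ } }

    -- As `s` takes finitely many values, the set is a finite union of pieces on which the first
    -- argument of `Q` is fixed. This is how a simple function is substituted into a measurable
    -- family.
    simple-glue : ∀ {s} → Simple S s → (Q : Carrier → Pred Point ℓ) → (∀ v → Measurable (Q v)) →
                  (∀ {v w x} → v ≈ w → Q v x → Q w x) → Measurable (λ x → Q (s x) x)
    simple-glue {s} s-simple Q mQ resp = resp-≐ (from values , λ {x} → to values (range x)) (measurable values)
      where
      open IsSimple s-simple
      Glued : List Carrier → Pred Point ℓ
      Glued []       = ∅
      Glued (v ∷ vs) = ((λ x → s x ≈ v) ∩ Q v) ∪ Glued vs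
      measurable : ∀ vs → Measurable (Glued vs)
      measurable []       = empty
      measurable (v ∷ vs) = ∪-measurable (∩-measurable (fibre v) (mQ v)) (measurable vs)
      from : ∀ vs {x} → Glued vs x → Q (s x) x
      from (v ∷ vs) (inj₁ (e , q)) = resp (sym e) q
      from (v ∷ vs) (inj₂ g)       = from vs g
      to : ∀ vs {x} → s x ∈ₗ vs → Q (s x) x → Glued vs x
      to (v ∷ vs) (here e)  q = inj₁ (e , resp e q)
      to (v ∷ vs) (there p) q = inj₂ (to vs p q)

    constant-simple : ∀ c → Simple S (λ _ → c)
    constant-simple c = finite-range⇒simple (c ∷ []) (λ _ → here refl) λ v → constant-measurable (c ≈ v)

    choose-simple : ∀ {A s t} → Measurable A → Simple S s → Simple S t → Simple S (λ x → choose A (s x) (t x) x)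
    choose-simple {A} {s} {t} mA s-simple t-simple = finite-range⇒simple (s.values ++ t.values) range fibre
      where
      module s = IsSimple s-simple
      module t = IsSimple t-simple
      range : ∀ x → choose A (s x) (t x) x ∈ₗ (s.values ++ t.values)
      range x = choose-elim (_∈ₗ (s.values ++ t.values))
        (λ _ → MembershipProperties.∈-++⁺ˡ S (s.range x)) (λ _ → MembershipProperties.∈-++⁺ʳ S s.values (t.range x))
      fibre : ∀ v → Measurable (λ x → choose A (s x) (t x) x ≈ v)
      fibre v = resp-≐ (to , from) (∪-measurable (∩-measurable mA (s.fibre v)) (∩-measurable (complement mA) (t.fibre v)))
        where
        to : ∀ {x} → ((A ∩ (λ x → s x ≈ v)) ∪ (∁ A ∩ (λ x → t x ≈ v))) x → choose A (s x) (t x) x ≈ v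
        to (inj₁ (a , e))  = trans (reflexive (choose-∈ a)) e
        to (inj₂ (¬a , e)) = trans (reflexive (choose-∉ ¬a)) e
        from : ∀ {x} → choose A (s x) (t x) x ≈ v → ((A ∩ (λ x → s x ≈ v)) ∪ (∁ A ∩ (λ x → t x ≈ v))) x
        from {x} e = cases (x ∈ A)
          (λ a → inj₁ (a , trans (reflexive (≡.sym (choose-∈ a))) e)) (λ ¬a → inj₂ (¬a , trans (reflexive (≡.sym (choose-∉ ¬a))) e))

  module _ (S T U : Setoid ℓ ℓ) where
    private
      module S = Setoid S
      module T = Setoid T
      module U = Setoid U

    map₂-simple : ∀ {s t} → Simple S s → Simple T t → (F : S.Carrier → T.Carrier → U.Carrier) →
                  F Preserves₂ S._≈_ ⟶ T._≈_ ⟶ U._≈_ → Simple U (λ x → F (s x) (t x))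
    map₂-simple {s} {t} s-simple t-simple F F-cong = finite-range⇒simple U
      (cartesianProductWith F (IsSimple.values s-simple) (IsSimple.values t-simple))
      (λ x → MembershipProperties.∈-cartesianProductWith⁺ S T U F-cong (IsSimple.range s-simple x) (IsSimple.range t-simple x))
      (λ u → simple-glue S s-simple (λ v x → F v (t x) U.≈ u)
        (λ v → simple-glue T t-simple (λ w _ → F v w U.≈ u) (λ w → constant-measurable (F v w U.≈ u))
          (λ e → U.trans (F-cong S.refl (T.sym e))))
        (λ e → U.trans (F-cong (S.sym e) T.refl)))

  module _ (S : Setoid ℓ ℓ) (V : LeftModule (CompleteOrderedField.ring ℝ) ℓ ℓ) where
    private module S = Setoid S
    open LeftModule V
    open Steps em M V
    open Membership S using () renaming (_∈_ to _∈ₗ_)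
    open UniqueSetoid S using (Unique)
    open ExtendedReals ℝ

    -- `ι` lets ℝ≥0-valued minorants and E-valued simple functions share one construction.
    module _ (ι : S.Carrier → Carrierᴹ) (ι-cong : ∀ {u v} → u S.≈ v → ι u ≈ᴹ ι v)
             {s : Point → S.Carrier} (fibre : ∀ v → Measurable (λ x → s x S.≈ v)) where

      FiniteFibre : S.Carrier → Set ℓ
      FiniteFibre v = ι v ≉ᴹ 0ᴹ → measure (_ , fibre v) ≢ ∞

      -- Values sent to 0 are dropped: their fibres may have infinite measure and contribute
      -- nothing.
      simple-step : ∀ vs → All FiniteFibre vs → Step
      simple-step []       []       = []
      simple-step (v ∷ vs) (p ∷ ps) with em {P = ι v ≈ᴹ 0ᴹ}
      ... | yes _  = simple-step vs ps
      ... | no v≉0 = (finite (_ , fibre v) (p v≉0) , ι v) ∷ simple-step vs ps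

      simple-step-∉ : ∀ vs ps {x} → ¬ (s x ∈ₗ vs) → ⟦ simple-step vs ps ⟧ x ≈ᴹ 0ᴹ
      simple-step-∉ []       []       _  = ≈ᴹ-refl
      simple-step-∉ (v ∷ vs) (p ∷ ps) s∉ with em {P = ι v ≈ᴹ 0ᴹ}
      ... | yes _ = simple-step-∉ vs ps (λ q → s∉ (there q))
      ... | no _  = ≈ᴹ-trans (+ᴹ-cong (indicator-∉ (λ q → s∉ (here q))) (simple-step-∉ vs ps (λ q → s∉ (there q)))) (+ᴹ-identityˡ 0ᴹ)

      -- Without duplicates in `vs`, only one fibre contains the point; a repeated value would be
      -- counted twice.
      simple-step-∈ : ∀ vs ps → Unique vs → ∀ {x} → s x ∈ₗ vs → ⟦ simple-step vs ps ⟧ x ≈ᴹ ι (s x)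
      simple-step-∈ (v ∷ vs) (p ∷ ps) (v∉vs ∷ uniq) {x} (here e) with em {P = ι v ≈ᴹ 0ᴹ}
      ... | yes v≈0 = ≈ᴹ-trans (simple-step-∉ vs ps (λ q → MembershipProperties.All[≉]⇒∉ S v∉vs (MembershipProperties.∈-resp-≈ S e q)))
                               (≈ᴹ-sym (≈ᴹ-trans (ι-cong e) v≈0))
      ... | no _    = ≈ᴹ-trans (+ᴹ-cong (indicator-∈ e)
                                 (simple-step-∉ vs ps (λ q → MembershipProperties.All[≉]⇒∉ S v∉vs (MembershipProperties.∈-resp-≈ S e q))))
                               (≈ᴹ-trans (+ᴹ-identityʳ _) (≈ᴹ-sym (ι-cong e)))
      simple-step-∈ (v ∷ vs) (p ∷ ps) (v∉vs ∷ uniq) {x} (there q) with em {P = ι v ≈ᴹ 0ᴹ}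
      ... | yes _ = simple-step-∈ vs ps uniq q
      ... | no _  = ≈ᴹ-trans (+ᴹ-cong (indicator-∉ λ e → MembershipProperties.All[≉]⇒∉ S v∉vs (MembershipProperties.∈-resp-≈ S e q))
                                      (simple-step-∈ vs ps uniq q)) (+ᴹ-identityˡ _)

-- The Lebesgue integral through simple minorants

module Lebesgue (em : ∀ {a} → ExcludedMiddle a) {ℓ} {ℝ : CompleteOrderedField ℓ} (M : MeasureSpace ℝ) where
  open CompleteOrderedField ℝ hiding (zero)
  open OrderedField em ℝ
  open ExtendedReals ℝ
  open ExtendedRealProperties ℝ
  open MeasureSpace M
  open MeasureProperties em M
  open Integration em M
  open RealSteps em M
  open SimpleFunctions em M
  open ≤-Reasoning

  ·∞-toReal : ∀ y x → (¬ proj₁ y ≈ 0# → x ≢ ∞) → y ·∞ x ≢ ∞ × toReal (y ·∞ x) ≈ toReal x * proj₁ y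
  ·∞-toReal (y , _) [ x , _ ] _ = (λ ()) , *-comm y x
  ·∞-toReal (y , _) ∞ h with em {P = y ≈ 0#}
  ... | yes _  = (λ ()) , sym (zeroˡ y)
  ... | no y≉0 = ⊥-elim (h y≉0 ≡.refl)

  ·∞-finite : ∀ y x → y ·∞ x ≢ ∞ → ¬ proj₁ y ≈ 0# → x ≢ ∞
  ·∞-finite (y , _) ∞ h y≉0 _ with em {P = y ≈ 0#}
  ... | yes y≈0 = y≉0 y≈0
  ... | no _    = h ≡.refl

  +-≢∞⁻ : ∀ x y → x +∞ y ≢ ∞ → x ≢ ∞ × y ≢ ∞
  +-≢∞⁻ [ _ ] [ _ ] _ = (λ ()) , (λ ())
  +-≢∞⁻ [ _ ] ∞     h = ⊥-elim (h ≡.refl)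
  +-≢∞⁻ ∞     _     h = ⊥-elim (h ≡.refl)

  module _ {φ : Point → ℝ≥0} (fibre : ∀ (v : ℝ≥0) → Measurable (λ x → proj₁ (φ x) ≈ proj₁ v)) where

    private
      lebesgueSum : List ℝ≥0 → [0,∞]
      lebesgueSum vs = foldr _+∞_ 0∞ (map (λ y → y ·∞ μ _ (fibre y)) vs)

      AllFinite : List ℝ≥0 → Set ℓ
      AllFinite = All (FiniteFibre ℝ≥0-setoid ℝᴹ proj₁ (λ e → e) {φ} fibre)

    lebesgueSum-step : ∀ vs (ps : AllFinite vs) → lebesgueSum vs ≢ ∞ ×
                       toReal (lebesgueSum vs) ≈ integral (simple-step ℝ≥0-setoid ℝᴹ proj₁ (λ e → e) {φ} fibre vs ps)
    lebesgueSum-step []       []       = (λ ()) , refl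
    lebesgueSum-step (v ∷ vs) (p ∷ ps) with lebesgueSum-step vs ps | ·∞-toReal v (μ _ (fibre v)) p | em {P = proj₁ v ≈ 0#}
    ... | tail≢∞ , tail≈ | head≢∞ , head≈ | yes v≈0 = +-≢∞ head≢∞ tail≢∞ ,
      trans (toReal-+ {v ·∞ μ _ (fibre v)} (+-≢∞ head≢∞ tail≢∞)) (trans (+-cong (trans head≈ (trans (*-congˡ v≈0) (zeroʳ _))) tail≈) (+-identityˡ _))
    ... | tail≢∞ , tail≈ | head≢∞ , head≈ | no _    = +-≢∞ head≢∞ tail≢∞ ,
      trans (toReal-+ {v ·∞ μ _ (fibre v)} (+-≢∞ head≢∞ tail≢∞)) (+-cong head≈ tail≈)

    -- A nonzero value times infinite measure is ∞, and a finite sum has only finite terms.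
    lebesgueSum-finite : ∀ vs → lebesgueSum vs ≢ ∞ → AllFinite vs
    lebesgueSum-finite []       _ = []
    lebesgueSum-finite (v ∷ vs) h with +-≢∞⁻ (v ·∞ μ _ (fibre v)) (lebesgueSum vs) h
    ... | head≢∞ , tail≢∞ = ·∞-finite v (μ _ (fibre v)) head≢∞ ∷ lebesgueSum-finite vs tail≢∞

  record Minorant (h : Point → Carrier) : Set (lsuc ℓ) where
    field
      function : Point → ℝ≥0
      isSimple : Simple ℝ≥0-setoid function
      below    : ∀ x → proj₁ (function x) ≤ h x

    value : Point → Carrier
    value x = proj₁ (function x)

    lebesgue : [0,∞]
    lebesgue = simpleLebesgue function isSimple

  open Minorant

  infix 4 _represents_
  record _represents_ (L : Step) (φ : Point → Carrier) : Set ℓ where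
    constructor agrees
    field at : ∀ x → ⟦ L ⟧ x ≈ φ x
  open _represents_ public

  lebesgue≤∫⁺ : ∀ {h} (φ : Minorant h) → lebesgue φ ≤⁺ ∫⁺ h
  lebesgue≤∫⁺ φ = proj₁ (proj₂ (supremum _)) (function φ , isSimple φ , below φ , ≡.refl)

  ∫⁺-least : ∀ {h b} → (∀ (φ : Minorant h) → lebesgue φ ≤⁺ b) → ∫⁺ h ≤⁺ b
  ∫⁺-least ub = proj₂ (proj₂ (supremum _)) λ { (φ , φ-simple , φ≤h , ≡.refl) → ub (record { function = φ ; isSimple = φ-simple ; below = φ≤h }) }

  private
    step-of : ∀ {h} (φ : Minorant h) (ps : All (FiniteFibre ℝ≥0-setoid ℝᴹ proj₁ (λ e → e) {function φ} (IsSimple.fibre (isSimple φ))) (IsSimple.values (isSimple φ))) →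
              Σ[ L ∈ Step ] L represents value φ × lebesgue φ ≢ ∞ × toReal (lebesgue φ) ≈ integral L
    step-of φ ps = simple-step ℝ≥0-setoid ℝᴹ proj₁ (λ e → e) {function φ} fibre values ps
                 , agrees (λ x → simple-step-∈ ℝ≥0-setoid ℝᴹ proj₁ (λ e → e) {function φ} fibre values ps unique (range x))
                 , lebesgueSum-step fibre values ps
      where open IsSimple (isSimple φ)

  -- The way an upper bound on `∫⁺` is used: it makes the fibres over nonzero values finite, so that
  -- the minorant becomes a step function with a real integral.
  minorant-step : ∀ {h a 0≤a} → ∫⁺ h ≤⁺ [ a , 0≤a ] → (φ : Minorant h) →
                  Σ[ L ∈ Step ] L represents value φ × integral L ≤ a
  minorant-step {h} {a} ∫h≤a φ with step-of φ (lebesgueSum-finite {function φ} (IsSimple.fibre (isSimple φ)) _ ([ ≤⁺-trans (lebesgue≤∫⁺ φ) ∫h≤a ]≢∞))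
  ... | L , L-rep , _ , eq = L , L-rep ,
    ≤.trans (≤.reflexive (sym eq)) (toReal-mono (≤⁺-trans (lebesgue≤∫⁺ φ) ∫h≤a) λ ())

  -- Where φ is nonzero the majorant is nonzero too, which confines φ to a set of finite measure;
  -- then step functions can be compared.
  lebesgue≤ : ∀ {h a 0≤a} (φ : Minorant h) (L : Step) → (∀ x → value φ x ≤ ⟦ L ⟧ x) → integral L ≤ a →
              lebesgue φ ≤⁺ [ a , 0≤a ]
  lebesgue≤ φ L φ≤L IL≤a with step-of φ (All.universal finite-fibre _)
    where
    open IsSimple (isSimple φ) using (fibre)
    finite-fibre : ∀ v → ¬ proj₁ v ≈ 0# → measure (_ , fibre v) ≢ ∞
    finite-fibre v v≉0 = nonzero-finite L (_ , fibre v) λ {x} φx≈v Lx≈0 →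
      v≉0 (≤.antisym (≤.trans (≤.reflexive (sym φx≈v)) (≤.trans (φ≤L x) (≤.reflexive Lx≈0))) (proj₂ v))
  ... | L′ , L′-rep , ≢∞ , eq = ≤⁺-trans (≤-toReal ≢∞ (toReal-nonneg (lebesgue φ))) [ ≤.trans (≤.reflexive eq)
    (≤.trans (integral-mono L′ L λ x → ≤.trans (≤.reflexive (at L′-rep x)) (φ≤L x)) IL≤a) ]≤

  -- The majorant may depend on the minorant; the estimates below build it from the minorant itself.
  ∫⁺≤ : ∀ {h a 0≤a} → (∀ (φ : Minorant h) → Σ[ L ∈ Step ] (∀ x → value φ x ≤ ⟦ L ⟧ x) × integral L ≤ a) →
        ∫⁺ h ≤⁺ [ a , 0≤a ]
  ∫⁺≤ H = ∫⁺-least λ φ → let L , φ≤L , IL≤a = H φ in lebesgue≤ φ L φ≤L IL≤a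

  zero-minorant : ∀ {h} → (∀ x → 0# ≤ h x) → Minorant h
  zero-minorant 0≤h = record { function = λ _ → 0# , ≤.refl ; isSimple = constant-simple ℝ≥0-setoid _ ; below = 0≤h }

  -- Were every simple minorant to have integral at most ∫⁺ g − ε, so would the supremum.
  near-optimal : ∀ {g G 0≤G} → (∀ x → 0# ≤ g x) → ∫⁺ g ≡ [ G , 0≤G ] → ∀ {ε} → 0# < ε →
                 Σ[ φ ∈ Minorant g ] Σ[ L ∈ Step ] L represents value φ × G ≤ integral L + ε
  near-optimal {g} {G} {0≤G} 0≤g eq {ε} 0<ε
    with em {P = Σ[ φ ∈ Minorant g ] Σ[ L ∈ Step ] L represents value φ × G ≤ integral L + ε}
  ... | yes p = p
  ... | no ¬p = ⊥-elim (<⇒≱ (x<x+y 0<ε) (begin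
      G + ε          ≤⟨ +-mono-≤ (toReal-mono (≤⁺-trans ≥G ∫g≤) λ ()) ≤.refl ⟩
      (G - ε) + ε    ≈⟨ +-comm _ _ ⟩
      ε + (G - ε)    ≈⟨ x+[y-x]≈y ε G ⟩
      G              ∎))
    where
    ≤G : ∫⁺ g ≤⁺ [ G , 0≤G ]
    ≤G = ≡.subst (_≤⁺ [ G , 0≤G ]) (≡.sym eq) ≤⁺-refl
    ≥G : [ G , 0≤G ] ≤⁺ ∫⁺ g
    ≥G = ≡.subst ([ G , 0≤G ] ≤⁺_) (≡.sym eq) ≤⁺-refl
    minorant-bound : (φ : Minorant g) → Σ[ L ∈ Step ] L represents value φ × integral L ≤ G - ε
    minorant-bound φ with minorant-step ≤G φ
    ... | L , L-rep , _ = L , L-rep , +-cancelˡ-≤ ε (begin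
      ε + integral L    ≈⟨ +-comm _ _ ⟩
      integral L + ε    ≤⟨ proj₁ (≰⇒> λ q → ¬p (φ , L , L-rep , q)) ⟩
      G                 ≈⟨ x+[y-x]≈y ε G ⟨
      ε + (G - ε)       ∎)
    -- An element of [0,∞] carries this proof. The zero minorant has a nonnegative integral and
    -- obeys the same bound.
    0≤G-ε : 0# ≤ G - ε
    0≤G-ε with minorant-bound (zero-minorant 0≤g)
    ... | L , L-rep , IL≤ = ≤.trans (integral-nonneg L λ x → ≤.reflexive (sym (at L-rep x))) IL≤
    ∫g≤ : ∫⁺ g ≤⁺ [ G - ε , 0≤G-ε ]
    ∫g≤ = ∫⁺≤ λ φ → let L , L-rep , IL≤ = minorant-bound φ in L , (λ x → ≤.reflexive (sym (at L-rep x))) , IL≤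

-- Scalar dominated convergence

module Domination (em : ∀ {a} → ExcludedMiddle a) {ℓ} {ℝ : CompleteOrderedField ℓ} (M : MeasureSpace ℝ) where
  open CompleteOrderedField ℝ hiding (zero)
  open OrderedField em ℝ
  open ExtendedReals ℝ
  open ExtendedRealProperties ℝ
  open MeasureSpace M
  open MeasureProperties em M
  open Integration em M
  open RealSteps em M
  open SimpleFunctions em M
  open Lebesgue em M
  open Minorant
  open ≤-Reasoning

  -- Functions are only ever compared with constants, so strict sublevel sets carry the
  -- measurability.
  MeasurableFunction : (Point → Carrier) → Set (lsuc ℓ)
  MeasurableFunction u = ∀ c → Measurable (λ x → u x < c)

  superlevel : ∀ {u} → MeasurableFunction u → ∀ c → Measurable (λ x → c ≤ u x)
  superlevel mu c = resp-≐ (≮⇒≥ , (λ c≤u u<c → <⇒≱ u<c c≤u)) (complement (mu c))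

  halfℝ≥0 : ℝ≥0 → ℝ≥0
  halfℝ≥0 (y , 0≤y) = proj₁ (halve y) , halve-nonneg (proj₂ (halve y)) 0≤y

  half+half : ∀ y → proj₁ (halfℝ≥0 y) + proj₁ (halfℝ≥0 y) ≈ proj₁ y
  half+half (y , _) = proj₂ (halve y)

  halfℝ≥0-cong : ∀ {y z : ℝ≥0} → proj₁ y ≈ proj₁ z → proj₁ (halfℝ≥0 y) ≈ proj₁ (halfℝ≥0 z)
  halfℝ≥0-cong {y} {z} e = double-cancel (trans (half+half y) (trans e (sym (half+half z))))

  -- If ψ ≤ u + v, then ½ψ ≤ u or ½ψ ≤ v at each point: splitting ψ accordingly loses a
  -- factor 2, but avoids approximating u and v by simple functions.
  ∫⁺-quasi-subadditive : ∀ {u v h a b 0≤a 0≤b} → MeasurableFunction u → (∀ x → 0# ≤ u x) → (∀ x → 0# ≤ v x) →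
    (∀ x → h x ≤ u x + v x) → ∫⁺ u ≤⁺ [ a , 0≤a ] → ∫⁺ v ≤⁺ [ b , 0≤b ] →
    ∀ {0≤c} → ∫⁺ h ≤⁺ [ (a + a) + (b + b) , 0≤c ]
  ∫⁺-quasi-subadditive {u} {v} {h} {a} {b} mu 0≤u 0≤v h≤u+v ∫u≤a ∫v≤b = ∫⁺≤ λ ψ →
    let open Split ψ
        L₁ , rep₁ , I₁≤a = minorant-step ∫u≤a ψ₁
        L₂ , rep₂ , I₂≤b = minorant-step ∫v≤b ψ₂
    in (L₁ ++ L₁) ++ (L₂ ++ L₂)
     , (λ x → ≤.reflexive (trans (covers x) (sym (trans (⟦++⟧ (L₁ ++ L₁) (L₂ ++ L₂) x) (+-cong
         (trans (⟦++⟧ L₁ L₁ x) (+-cong (at rep₁ x) (at rep₁ x)))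
         (trans (⟦++⟧ L₂ L₂ x) (+-cong (at rep₂ x) (at rep₂ x))))))))
     , ≤.trans (≤.reflexive (trans (integral-++ (L₁ ++ L₁) (L₂ ++ L₂)) (+-cong (integral-++ L₁ L₁) (integral-++ L₂ L₂))))
         (+-mono-≤ (+-mono-≤ I₁≤a I₁≤a) (+-mono-≤ I₂≤b I₂≤b))
    where
    module Split (ψ : Minorant h) where
      ½ψ : Point → ℝ≥0
      ½ψ x = halfℝ≥0 (function ψ x)
      0ℝ≥0 : ℝ≥0
      0ℝ≥0 = 0# , ≤.refl
      A : Pred Point ℓ
      A x = proj₁ (½ψ x) ≤ u x
      mA : Measurable A
      mA = simple-glue ℝ≥0-setoid (isSimple ψ) (λ y x → proj₁ (halfℝ≥0 y) ≤ u x)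
        (λ y → superlevel mu (proj₁ (halfℝ≥0 y)))
        (λ {y} {z} e p → ≤.trans (≤.reflexive (halfℝ≥0-cong {z} {y} (sym e))) p)
      ½ψ-simple : Simple ℝ≥0-setoid ½ψ
      ½ψ-simple = map₂-simple ℝ≥0-setoid ℝ≥0-setoid ℝ≥0-setoid (isSimple ψ) (isSimple ψ) (λ y _ → halfℝ≥0 y)
        (λ {y} {z} e _ → halfℝ≥0-cong {y} {z} e)
      0-simple : Simple ℝ≥0-setoid (λ _ → 0ℝ≥0)
      0-simple = constant-simple ℝ≥0-setoid 0ℝ≥0
      ψ₁ : Minorant u
      ψ₁ = record
        { function = λ x → choose A (½ψ x) 0ℝ≥0 x
        ; isSimple = choose-simple ℝ≥0-setoid mA ½ψ-simple 0-simple
        ; below    = ψ₁≤u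
        }
        where
        ψ₁≤u : ∀ x → proj₁ (choose A (½ψ x) 0ℝ≥0 x) ≤ u x
        ψ₁≤u x = choose-elim (λ y → proj₁ y ≤ u x) (λ a → a) (λ _ → 0≤u x)
      ψ₂ : Minorant v
      ψ₂ = record
        { function = λ x → choose A 0ℝ≥0 (½ψ x) x
        ; isSimple = choose-simple ℝ≥0-setoid mA 0-simple ½ψ-simple
        ; below    = ψ₂≤v
        }
        where
        ψ₂≤v : ∀ x → proj₁ (choose A 0ℝ≥0 (½ψ x) x) ≤ v x
        -- Off `A`, ½ψ exceeds u, so the other half of ψ must fit below v.
        ψ₂≤v x = choose-elim (λ y → proj₁ y ≤ v x) (λ _ → 0≤v x) λ ¬a → +-cancelˡ-≤ (proj₁ (½ψ x)) (begin
          proj₁ (½ψ x) + proj₁ (½ψ x)  ≈⟨ half+half (function ψ x) ⟩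
          value ψ x                    ≤⟨ below ψ x ⟩
          h x                          ≤⟨ h≤u+v x ⟩
          u x + v x                    ≤⟨ +-mono-≤ (proj₁ (≰⇒> ¬a)) ≤.refl ⟩
          proj₁ (½ψ x) + v x           ∎)
      double : ℝ≥0 → Carrier
      double y = proj₁ y + proj₁ y
      covers : ∀ x → value ψ x ≈ (value ψ₁ x + value ψ₁ x) + (value ψ₂ x + value ψ₂ x)
      covers x = cases (x ∈ A)
        (λ a → trans (sym (half+half (function ψ x))) (trans (sym (trans (+-congˡ (+-identityʳ 0#)) (+-identityʳ _)))
          (reflexive (≡.cong₂ (λ y z → double y + double z) (≡.sym (choose-∈ a)) (≡.sym (choose-∈ a))))))
        (λ ¬a → trans (sym (half+half (function ψ x))) (trans (sym (trans (+-congʳ (+-identityʳ 0#)) (+-identityˡ _)))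
          (reflexive (≡.cong₂ (λ y z → double y + double z) (≡.sym (choose-∉ ¬a)) (≡.sym (choose-∉ ¬a))))))

  restrict : MeasurableSet → Step → Step
  restrict B = map λ (A , v) → A ∩ᶠ B , v

  restrict-∈ : ∀ B L {x} → x ∈ proj₁ B → ⟦ restrict B L ⟧ x ≈ ⟦ L ⟧ x
  restrict-∈ B []            b = refl
  restrict-∈ B ((A , v) ∷ L) {x} b = +-cong head (restrict-∈ B L b)
    where
    head : indicator (set (A ∩ᶠ B)) v x ≈ indicator (set A) v x
    head = cases (x ∈ set A)
      (λ a → trans (indicator-∈ (a , b)) (sym (indicator-∈ a)))
      (λ ¬a → trans (indicator-∉ (λ { (a , _) → ¬a a })) (sym (indicator-∉ ¬a)))

  restrict-∉ : ∀ B L {x} → x ∉ proj₁ B → ⟦ restrict B L ⟧ x ≈ 0#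
  restrict-∉ B []            ¬b = refl
  restrict-∉ B ((A , v) ∷ L) ¬b = trans (+-cong (indicator-∉ (λ { (_ , b) → ¬b b })) (restrict-∉ B L ¬b)) (+-identityʳ 0#)

  -- For `δ ≥ 0`, a majorant of the constant `δ` on the support of `L`. Overlapping sets count
  -- repeatedly, which an upper bound tolerates.
  levels : Carrier → Step → Step
  levels δ = map λ (A , _) → A , δ

  totalVolume : Step → Carrier
  totalVolume []            = 0#
  totalVolume ((A , _) ∷ L) = volume A + totalVolume L

  totalVolume-nonneg : ∀ L → 0# ≤ totalVolume L
  totalVolume-nonneg []            = ≤.refl
  totalVolume-nonneg ((A , _) ∷ L) = 0≤+ (volume-nonneg A) (totalVolume-nonneg L)

  integral-levels : ∀ δ L → integral (levels δ L) ≈ δ * totalVolume L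
  integral-levels δ []            = sym (zeroʳ δ)
  integral-levels δ ((A , _) ∷ L) = trans (+-cong (*-comm _ δ) (integral-levels δ L)) (sym (distribˡ δ _ _))

  indicator-nonneg : ∀ {A δ x} → 0# ≤ δ → 0# ≤ indicator A δ x
  indicator-nonneg 0≤δ = choose-elim (0# ≤_) (λ _ → 0≤δ) (λ _ → ≤.refl)

  ⟦levels⟧-nonneg : ∀ {δ} → 0# ≤ δ → ∀ L x → 0# ≤ ⟦ levels δ L ⟧ x
  ⟦levels⟧-nonneg 0≤δ []            x = ≤.refl
  ⟦levels⟧-nonneg 0≤δ ((A , _) ∷ L) x = 0≤+ (indicator-nonneg 0≤δ) (⟦levels⟧-nonneg 0≤δ L x)

  ⟦levels⟧-≥ : ∀ {δ} → 0# ≤ δ → ∀ L {x} → ¬ (⟦ L ⟧ x ≈ 0#) → δ ≤ ⟦ levels δ L ⟧ x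
  ⟦levels⟧-≥ 0≤δ []            Lx≉0 = ⊥-elim (Lx≉0 refl)
  ⟦levels⟧-≥ {δ} 0≤δ ((A , v) ∷ L) {x} Lx≉0 = cases (x ∈ set A)
    (λ a → ≤.trans (x≤x+y (⟦levels⟧-nonneg 0≤δ L x)) (≤.reflexive (+-congʳ (sym (indicator-∈ a)))))
    (λ ¬a → ≤.trans (⟦levels⟧-≥ 0≤δ L λ e → Lx≉0 (trans (+-cong (indicator-∉ ¬a) e) (+-identityʳ 0#)))
      (x≤y+x (indicator-nonneg 0≤δ)))

  -- Each of the finitely many summands becomes small by continuity from above; ε is halved once per
  -- summand.
  restrict-small : (B : ℕ → MeasurableSet) → (∀ {m n} → m ℕ.≤ n → proj₁ (B n) ⊆ proj₁ (B m)) →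
                   (∀ {x} → ¬ (∀ n → x ∈ proj₁ (B n))) → ∀ L {ε} → 0# < ε →
                   ∃[ N ] ∀ n → N ℕ.≤ n → integral (restrict (B n) L) ≤ ε
  restrict-small B antitone vanishing []            0<ε = 0 , λ _ _ → proj₁ 0<ε
  restrict-small B antitone vanishing ((A , v) ∷ L) {ε} 0<ε =
    let δ , 0<δ , δ+δ≈ε = halve⁺ 0<ε
        N₁ , small₁ = head 0<δ (≤.total 0# v)
        N₂ , small₂ = restrict-small B antitone vanishing L 0<δ
    in N₁ ℕ.⊔ N₂ , λ n N≤n → ≤.trans
      (+-mono-≤ (small₁ n (ℕ.≤-trans (ℕ.m≤m⊔n N₁ N₂) N≤n)) (small₂ n (ℕ.≤-trans (ℕ.m≤n⊔m N₁ N₂) N≤n)))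
      (≤.reflexive δ+δ≈ε)
    where
    head : ∀ {δ} → 0# < δ → (0# ≤ v ⊎ v ≤ 0#) → ∃[ N ] ∀ n → N ℕ.≤ n → volume (A ∩ᶠ B n) * v ≤ δ
    -- A nonpositive value can only lower the sum.
    head 0<δ (inj₂ v≤0) = 0 , λ n _ → ≤.trans (*-monoˡ-≤ (volume-nonneg (A ∩ᶠ B n)) v≤0) (≤.trans (≤.reflexive (zeroʳ _)) (proj₁ 0<δ))
    head {δ} 0<δ (inj₁ 0≤v) =
      let η , 0<η , ηv≤δ = small-multiple 0≤v 0<δ
          N , small = volume-continuous A B antitone vanishing 0<η
      in N , λ n N≤n → begin
        volume (A ∩ᶠ B n) * v   ≈⟨ *-comm _ v ⟩
        v * volume (A ∩ᶠ B n)   ≤⟨ *-monoˡ-≤ 0≤v (small n N≤n) ⟩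
        v * η                   ≈⟨ *-comm v η ⟩
        η * v                   ≤⟨ ηv≤δ ⟩
        δ                       ∎

  shift-≤ : ∀ {a p s t} → p + a ≤ s + t → a ≤ s + (- p + t)
  shift-≤ {a} {p} {s} {t} h = +-cancelˡ-≤ p (begin
    p + a                    ≤⟨ h ⟩
    s + t                    ≈⟨ +-congˡ (+-identityˡ t) ⟨
    s + (0# + t)             ≈⟨ +-congˡ (+-congʳ (-‿inverseʳ p)) ⟨
    s + (p + - p + t)        ≈⟨ solve 4 (λ s p q t → s :+ (p :+ q :+ t) := p :+ (s :+ (q :+ t))) refl s p (- p) t ⟩
    p + (s + (- p + t))      ∎)
    where open Solver using (solve; _:=_; _:+_)

  -- Given φ nearly optimal for g, any minorant ψ of h n is dominated by
  -- (ψ ⊔ φ) − φ, of integral at most ε, plus ψ ⊓ φ, which is at most φ where some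
  -- later h m exceeds δ and at most δ elsewhere on the support of φ.
  dominated-convergence : ∀ {g} → (∀ x → 0# ≤ g x) → ∫⁺ g ≢ ∞ → (h : ℕ → Point → Carrier) →
    (∀ n → MeasurableFunction (h n)) → (∀ n x → h n x ≤ g x) →
    (∀ x ε → 0# < ε → ∃[ N ] ∀ n → N ℕ.≤ n → h n x < ε) → (λ n → ∫⁺ (h n)) ⟶0
  dominated-convergence {g} 0≤g ∫g≢∞ h mh h≤g h→0 ε 0<ε 0≤ε = go (∫⁺ g) ≡.refl
    where
    go : ∀ G → ∫⁺ g ≡ G → ∃[ N ] ∀ n → N ℕ.≤ n → ∫⁺ (h n) ≤⁺ [ ε , 0≤ε ]
    go ∞ eq = ⊥-elim (∫g≢∞ eq)
    go [ G , 0≤G ] eq = proj₁ small , bound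
      where
      -- Three errors of size η will add up: from the near-optimality of φ, from the sets `B n` and
      -- from the level δ. A quarter of ε leaves room for them.
      ε/2 = halve⁺ 0<ε
      ε/4 = halve⁺ (proj₁ (proj₂ ε/2))
      η = proj₁ ε/4
      0<η = proj₁ (proj₂ ε/4)
      η+[η+η]≤ε : η + (η + η) ≤ ε
      η+[η+η]≤ε = begin
        η + (η + η)              ≤⟨ +-mono-≤ (x≤x+y (proj₁ 0<η)) ≤.refl ⟩
        (η + η) + (η + η)        ≈⟨ +-cong (proj₂ (proj₂ ε/4)) (proj₂ (proj₂ ε/4)) ⟩
        proj₁ ε/2 + proj₁ ε/2    ≈⟨ proj₂ (proj₂ ε/2) ⟩
        ε                        ∎
      optimal = near-optimal 0≤g eq 0<η
      φ = proj₁ optimal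
      L = proj₁ (proj₂ optimal)
      L-rep = proj₁ (proj₂ (proj₂ optimal))
      G≤ = proj₂ (proj₂ (proj₂ optimal))
      -- δ times the total volume of the sets of `L` is to be at most η.
      δ-choice = small-multiple (totalVolume-nonneg L) 0<η
      δ = proj₁ δ-choice
      0<δ = proj₁ (proj₂ δ-choice)
      -- The union runs over the whole tail because the sets where `h n ≥ δ` need not decrease with
      -- n.
      B : ℕ → MeasurableSet
      B n = ⋃ ℕ (λ k x → δ ≤ h (k ℕ.+ n) x) , union (λ k → superlevel (mh (k ℕ.+ n)) δ)
      antitone : ∀ {m n} → m ℕ.≤ n → proj₁ (B n) ⊆ proj₁ (B m)
      antitone {m} {n} m≤n {x} (k , δ≤h) = k ℕ.+ (n ℕ.∸ m) , ≡.subst (λ i → δ ≤ h i x)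
        (≡.trans (≡.cong (k ℕ.+_) (≡.sym (ℕ.m∸n+n≡m m≤n))) (≡.sym (ℕ.+-assoc k (n ℕ.∸ m) m))) δ≤h
      vanishing : ∀ {x} → ¬ (∀ n → x ∈ proj₁ (B n))
      vanishing {x} b =
        let N , h<δ = h→0 x δ 0<δ
            k , δ≤h = b N
        in <⇒≱ (h<δ (k ℕ.+ N) (ℕ.m≤n+m N k)) δ≤h
      small = restrict-small B antitone vanishing L 0<η
      bound : ∀ n → proj₁ small ℕ.≤ n → ∫⁺ (h n) ≤⁺ [ ε , 0≤ε ]
      bound n N≤n = ∫⁺≤ majorant
        where
        majorant : (ψ : Minorant (h n)) → Σ[ R ∈ Step ] (∀ x → value ψ x ≤ ⟦ R ⟧ x) × integral R ≤ ε
        majorant ψ = R , ψ≤R , IR≤ε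
          where
          _⊔ℝ≥0_ : ℝ≥0 → ℝ≥0 → ℝ≥0
          (y , 0≤y) ⊔ℝ≥0 (z , _) = y ⊔ z , ≤.trans 0≤y (x≤x⊔y y z)
          -- Still below g, so its integral is at most G and exceeds that of φ by at most η.
          ψ⊔φ : Minorant g
          ψ⊔φ = record
            { function = λ x → function ψ x ⊔ℝ≥0 function φ x
            ; isSimple = map₂-simple ℝ≥0-setoid ℝ≥0-setoid ℝ≥0-setoid (isSimple ψ) (isSimple φ) _⊔ℝ≥0_ ⊔-cong
            ; below    = λ x → ⊔-lub (≤.trans (below ψ x) (h≤g n x)) (below φ x)
            }
          step = minorant-step {0≤a = 0≤G} (≡.subst (_≤⁺ [ G , 0≤G ]) (≡.sym eq) ≤⁺-refl) ψ⊔φ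
          L⊔ = proj₁ step
          R = L⊔ ++ (negate L ++ (restrict (B n) L ++ levels δ L))
          ⟦R⟧ : ∀ x → ⟦ R ⟧ x ≈ (value ψ x ⊔ value φ x) + (- value φ x + (⟦ restrict (B n) L ⟧ x + ⟦ levels δ L ⟧ x))
          ⟦R⟧ x = trans (⟦++⟧ L⊔ _ x) (+-cong (at (proj₁ (proj₂ step)) x) (trans (⟦++⟧ (negate L) _ x)
            (+-cong (trans (⟦negate⟧ L x) (-‿cong (at L-rep x))) (⟦++⟧ (restrict (B n) L) _ x))))
          ψ≤R : ∀ x → value ψ x ≤ ⟦ R ⟧ x
          ψ≤R x = ≤.trans (shift-≤ key) (≤.reflexive (sym (⟦R⟧ x)))
            where
            p = value φ x
            q = ⟦ levels δ L ⟧ x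
            r = ⟦ restrict (B n) L ⟧ x
            0≤q : 0# ≤ q
            0≤q = ⟦levels⟧-nonneg (proj₁ 0<δ) L x
            -- On `B n`, r is the value of φ. Off `B n`, either φ vanishes and ψ ≤ ψ ⊔ φ suffices,
            -- or ψ ≤ h n < δ ≤ q.
            key : p + value ψ x ≤ (value ψ x ⊔ p) + (r + q)
            key = cases (x ∈ proj₁ (B n))
              (λ b → begin
                p + value ψ x                    ≈⟨ +-comm _ _ ⟩
                value ψ x + p                    ≤⟨ +-mono-≤ (x≤x⊔y _ p) (x≤x+y 0≤q) ⟩
                (value ψ x ⊔ p) + (p + q)        ≈⟨ +-congˡ (+-congʳ (trans (restrict-∈ (B n) L b) (at L-rep x))) ⟨
                (value ψ x ⊔ p) + (r + q)        ∎)
              λ ¬b → cases (p ≈ 0#)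
                (λ p≈0 → begin
                  p + value ψ x                    ≈⟨ +-comm _ _ ⟩
                  value ψ x + p                    ≤⟨ +-mono-≤ (x≤x⊔y _ p) (≤.trans (≤.reflexive p≈0)
                                                        (0≤+ (≤.reflexive (sym (restrict-∉ (B n) L ¬b))) 0≤q)) ⟩
                  (value ψ x ⊔ p) + (r + q)        ∎)
                (λ p≉0 → +-mono-≤ (x≤y⊔x (value ψ x) p) (begin
                  value ψ x    ≤⟨ below ψ x ⟩
                  h n x        ≤⟨ proj₁ (≰⇒> λ δ≤h → ¬b (0 , δ≤h)) ⟩
                  δ            ≤⟨ ⟦levels⟧-≥ (proj₁ 0<δ) L (λ e → p≉0 (trans (sym (at L-rep x)) e)) ⟩
                  q            ≤⟨ x≤y+x (≤.reflexive (sym (restrict-∉ (B n) L ¬b))) ⟩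
                  r + q        ∎))
          I = integral L
          IR≤ε : integral R ≤ ε
          IR≤ε = begin
            integral R
              ≈⟨ trans (integral-++ L⊔ _) (+-congˡ (trans (integral-++ (negate L) _)
                   (+-cong (integral-negate L) (integral-++ (restrict (B n) L) _)))) ⟩
            integral L⊔ + (- I + (integral (restrict (B n) L) + integral (levels δ L)))
              ≤⟨ +-mono-≤ (≤.trans (proj₂ (proj₂ step)) G≤) (+-monoʳ-≤ (- I) (+-mono-≤ (proj₂ small n N≤n)
                   (≤.trans (≤.reflexive (integral-levels δ L)) (proj₂ (proj₂ δ-choice))))) ⟩
            (I + η) + (- I + (η + η))
              ≈⟨ solve 3 (λ i η j → (i :+ η) :+ (j :+ (η :+ η)) := (i :+ j) :+ (η :+ (η :+ η))) refl I η (- I) ⟩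
            (I + - I) + (η + (η + η))
              ≈⟨ trans (+-congʳ (-‿inverseʳ I)) (+-identityˡ _) ⟩
            η + (η + η)
              ≤⟨ η+[η+η]≤ε ⟩
            ε ∎
            where open Solver using (solve; _:=_; _:+_)

-- Measurability of limits of simple functions, and nearest points

module StronglyMeasurable (em : ∀ {a} → ExcludedMiddle a) {ℓ} {ℝ : CompleteOrderedField ℓ} (M : MeasureSpace ℝ)
                          (E : BanachSpace ℝ) where
  open CompleteOrderedField ℝ hiding (zero)
  open OrderedField em ℝ
  open BanachSpace E
  open Norm em ℝ E
  open MeasureSpace M
  open MeasureProperties em M
  open SimpleFunctions em M
  open Domination em M using (MeasurableFunction)
  open ≤-Reasoning
  open Solver using (solve; _:=_; _:+_)

  -- The limit lies below c exactly when some tail of the sequence stays below c by a fixed margin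
  -- `null j`, a countable combination of sublevel sets.
  measurable-limit : ∀ {u : ℕ → Point → Carrier} {v} → (∀ n → MeasurableFunction (u n)) →
    (∀ x ε → 0# < ε → ∃[ N ] ∀ n → N ℕ.≤ n → u n x ≤ v x + ε × v x ≤ u n x + ε) → MeasurableFunction v
  measurable-limit {u} {v} mu u→v c = resp-≐ (to , from)
    (union λ j → union λ N → ⋂-measurable λ k → mu (k ℕ.+ N) (c - null j))
    where
    Eventually : Pred Point ℓ
    Eventually = ⋃ ℕ λ j → ⋃ ℕ λ N x → ∀ k → u (k ℕ.+ N) x < c - null j
    c≈ : ∀ j → (c - null j) + null j ≈ c
    c≈ j = trans (+-comm _ _) (x+[y-x]≈y (null j) c)
    to : ∀ {x} → Eventually x → v x < c
    to {x} (j , N , u<) =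
      let N′ , close = u→v x (null j) (proj₂ (null⁺ j)) in begin-strict
      v x                            ≤⟨ proj₂ (close (N′ ℕ.+ N) (ℕ.m≤m+n N′ N)) ⟩
      u (N′ ℕ.+ N) x + null j        <⟨ +-monoˡ-< (u< N′) ≤.refl ⟩
      (c - null j) + null j          ≈⟨ c≈ j ⟩
      c                              ∎
    from : ∀ {x} → v x < c → Eventually x
    from {x} v<c =
      let j , null<          = null-small (x<y⇒0<y-x v<c)
          N , close          = u→v x (null (suc j)) (proj₂ (null⁺ (suc j)))
      -- `null j` is split in two: one half is the margin below c, the other the approximation
      -- error.
      in suc j , N , λ k → ≰⇒> λ c≤u → <⇒≱ null< (+-cancelˡ-≤ (v x) (begin
        v x + (c - v x)                          ≈⟨ x+[y-x]≈y (v x) c ⟩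
        c                                        ≈⟨ c≈ (suc j) ⟨
        (c - null (suc j)) + null (suc j)        ≤⟨ +-mono-≤ (≤.trans c≤u (proj₁ (close (k ℕ.+ N) (ℕ.m≤n+m N k)))) ≤.refl ⟩
        (v x + null (suc j)) + null (suc j)      ≈⟨ +-assoc _ _ _ ⟩
        v x + (null (suc j) + null (suc j))      ≈⟨ +-congˡ (null-suc j) ⟩
        v x + null j                             ∎))

  -- Constant 2, uniformly in x: in a difference of two distances, each may move by the full ‖ y -ᴱ
  -- z ‖.
  Lipschitz : (Carrierᴹ → Point → Carrier) → Set ℓ
  Lipschitz Ψ = ∀ y z x → Ψ y x ≤ Ψ z x + (‖ y -ᴱ z ‖ + ‖ y -ᴱ z ‖)

  -- Stability under substitution into Lipschitz integrands is inherited by pointwise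
  -- limits, and unlike Borel measurability it needs no separability to be useful.
  Tame : (Point → Carrierᴹ) → Set (lsuc ℓ)
  Tame F = ∀ Ψ → Lipschitz Ψ → (∀ y → MeasurableFunction (Ψ y)) → MeasurableFunction (λ x → Ψ (F x) x)

  simple⇒tame : ∀ {s} → Simple ≈ᴹ-setoid s → Tame s
  simple⇒tame s-simple Ψ lip mΨ c = simple-glue ≈ᴹ-setoid s-simple (λ y x → Ψ y x < c) (λ y → mΨ y c)
    -- Compatibility of `Ψ` with `≈ᴹ` comes from the Lipschitz bound at distance 0.
    λ {y} {z} {x} y≈z Ψy<c → begin-strict
      Ψ z x                                ≤⟨ lip z y x ⟩
      Ψ y x + (‖ z -ᴱ y ‖ + ‖ z -ᴱ y ‖)    ≈⟨ +-congˡ (+-cong (dist-zero (≈ᴹ-sym y≈z)) (dist-zero (≈ᴹ-sym y≈z))) ⟩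
      Ψ y x + (0# + 0#)                    ≈⟨ trans (+-congˡ (+-identityʳ 0#)) (+-identityʳ _) ⟩
      Ψ y x                                <⟨ Ψy<c ⟩
      c                                    ∎
    where
    dist-zero : ∀ {u v} → u ≈ᴹ v → ‖ u -ᴱ v ‖ ≈ 0#
    dist-zero {u} {v} u≈v = trans (‖‖-cong (-ᴱ-cong u≈v ≈ᴹ-refl)) (u-u≈0 v)

  -- By the Lipschitz bound, Ψ (F n x) x tends to Ψ (G x) x, and sublevel measurability passes to
  -- limits.
  tame-limit : ∀ {F : ℕ → Point → Carrierᴹ} {G} → (∀ n → Tame (F n)) → (∀ x → (λ n → F n x) ⟶ G x) → Tame G
  tame-limit {F} {G} F-tame F⟶G Ψ lip mΨ = measurable-limit (λ n → F-tame n Ψ lip mΨ) λ x ε 0<ε →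
    let δ , 0<δ , δ+δ≈ε = halve⁺ 0<ε
        N , close       = F⟶G x δ 0<δ
    in N , λ n N≤n →
      let d≤δ  = proj₁ (close n N≤n)
          d≤δ′ = ≤.trans (≤.reflexive (dist-sym (G x) (F n x))) d≤δ
      in ≤.trans (lip (F n x) (G x) x) (+-monoʳ-≤ _ (≤.trans (+-mono-≤ d≤δ d≤δ) (≤.reflexive δ+δ≈ε)))
       , ≤.trans (lip (G x) (F n x) x) (+-monoʳ-≤ _ (≤.trans (+-mono-≤ d≤δ′ d≤δ′) (≤.reflexive δ+δ≈ε)))

  dist-lipschitz : ∀ y z a → ‖ y -ᴱ a ‖ ≤ ‖ z -ᴱ a ‖ + ‖ y -ᴱ z ‖
  dist-lipschitz y z a = ≤.trans (dist-triangle y z a) (≤.reflexive (+-comm _ _))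

  dist-lipschitz′ : ∀ a y z → ‖ a -ᴱ y ‖ ≤ ‖ a -ᴱ z ‖ + ‖ y -ᴱ z ‖
  dist-lipschitz′ a y z = dist-triangleʳ a z y

  swap-bound : ∀ {a b d e} → d ≈ e → a ≤ b + d → a ≤ b + e
  swap-bound d≈e p = ≤.trans p (≤.reflexive (+-congˡ d≈e))

  double-bound : ∀ {a b d} → 0# ≤ d → a ≤ b + d → a ≤ b + (d + d)
  double-bound 0≤d p = ≤.trans p (+-monoʳ-≤ _ (x≤x+y 0≤d))

  difference-bound : ∀ {a b a′ b′ d} → a ≤ a′ + d → b′ ≤ b + d → a - b ≤ (a′ - b′) + (d + d)
  difference-bound {a} {b} {a′} {b′} {d} p q = +-cancelʳ-≤ (b + b′) (begin
    (a - b) + (b + b′)                     ≈⟨ solve 4 (λ a n b b′ → (a :+ n) :+ (b :+ b′) := (a :+ b′) :+ (b :+ n)) refl a (- b) b b′ ⟩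
    (a + b′) + (b - b)                     ≈⟨ trans (+-congˡ (-‿inverseʳ b)) (+-identityʳ _) ⟩
    a + b′                                 ≤⟨ +-mono-≤ p q ⟩
    (a′ + d) + (b + d)                     ≈⟨ trans (+-congˡ (-‿inverseʳ b′)) (+-identityʳ _) ⟨
    ((a′ + d) + (b + d)) + (b′ - b′)       ≈⟨ solve 5 (λ a′ d b b′ n → ((a′ :+ d) :+ (b :+ d)) :+ (b′ :+ n) :=
                                                ((a′ :+ n) :+ (d :+ d)) :+ (b :+ b′)) refl a′ d b b′ (- b′) ⟩
    ((a′ - b′) + (d + d)) + (b + b′)       ∎)

  -- One argument is substituted at a time: with both points fixed the distance is a constant, then
  -- `G` and finally `F` is put in.
  tame-distance : ∀ {F G} → Tame F → Tame G → MeasurableFunction (λ x → ‖ F x -ᴱ G x ‖)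
  tame-distance {F} {G} F-tame G-tame = F-tame (λ y x → ‖ y -ᴱ G x ‖)
    (λ y z x → double-bound (‖‖-nonneg _) (dist-lipschitz y z (G x)))
    λ y → G-tame (λ z _ → ‖ y -ᴱ z ‖)
      (λ z w _ → double-bound (‖‖-nonneg _) (dist-lipschitz′ y z w))
      λ z c → constant-measurable (‖ y -ᴱ z ‖ < c)

  -- The comparison is the sign of a difference of distances. `F` enters both of them, which
  -- accounts for the constant 2 in `Lipschitz`.
  tame-closer : ∀ {F G H} → Tame F → Tame G → Tame H → Measurable (λ x → ‖ F x -ᴱ G x ‖ < ‖ F x -ᴱ H x ‖)
  tame-closer {F} {G} {H} F-tame G-tame H-tame = resp-≐ (negative⇒< , <⇒negative)
    (F-tame (λ y x → ‖ y -ᴱ G x ‖ - ‖ y -ᴱ H x ‖)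
      (λ y z x → difference-bound (dist-lipschitz y z (G x)) (swap-bound (dist-sym z y) (dist-lipschitz z y (H x))))
      (λ y → G-tame (λ z x → ‖ y -ᴱ z ‖ - ‖ y -ᴱ H x ‖)
        (λ z w x → difference-bound (dist-lipschitz′ y z w) (x≤x+y (‖‖-nonneg _)))
        (λ z → H-tame (λ w _ → ‖ y -ᴱ z ‖ - ‖ y -ᴱ w ‖)
          (λ w w′ x → difference-bound (x≤x+y (‖‖-nonneg _)) (swap-bound (dist-sym w′ w) (dist-lipschitz′ y w′ w)))
          (λ w c → constant-measurable (‖ y -ᴱ z ‖ - ‖ y -ᴱ w ‖ < c))))
      0#)
    where
    negative⇒< : ∀ {a b} → a - b < 0# → a < b
    negative⇒< a-b<0 = ≰⇒> λ b≤a → <⇒≱ a-b<0 (x≤y⇒0≤y-x b≤a)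
    <⇒negative : ∀ {a b} → a < b → a - b < 0#
    <⇒negative a<b = ≰⇒> λ 0≤a-b → <⇒≱ a<b (0≤y-x⇒x≤y 0≤a-b)

  module _ {i} {I : Set i} (F : Point → Carrierᴹ) (c : I → Point → Carrierᴹ) where

    nearest : List I → Point → Carrierᴹ
    nearest []       x = 0ᴹ
    nearest (i ∷ is) x = choose (λ x → ‖ F x -ᴱ c i x ‖ < ‖ F x -ᴱ nearest is x ‖) (c i x) (nearest is x) x

    nearest-simple : Tame F → (∀ i → Simple ≈ᴹ-setoid (c i)) → ∀ is → Simple ≈ᴹ-setoid (nearest is)
    nearest-simple F-tame c-simple []       = constant-simple ≈ᴹ-setoid 0ᴹ
    nearest-simple F-tame c-simple (i ∷ is) = choose-simple ≈ᴹ-setoid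
      (tame-closer F-tame (simple⇒tame (c-simple i)) (simple⇒tame rest)) (c-simple i) rest
      where rest = nearest-simple F-tame c-simple is

    nearest-step : ∀ i is x → ‖ F x -ᴱ nearest (i ∷ is) x ‖ ≤ ‖ F x -ᴱ nearest is x ‖
    nearest-step i is x = choose-elim (λ v → ‖ F x -ᴱ v ‖ ≤ ‖ F x -ᴱ nearest is x ‖) proj₁ (λ _ → ≤.refl)

    nearest-≤-norm : ∀ is x → ‖ F x -ᴱ nearest is x ‖ ≤ ‖ F x ‖
    nearest-≤-norm []       x = ≤.reflexive (‖‖-cong (u-0≈u (F x)))
    nearest-≤-norm (i ∷ is) x = ≤.trans (nearest-step i is x) (nearest-≤-norm is x)

    nearest-≤ : ∀ {i is} → i ∈ₚ is → ∀ x → ‖ F x -ᴱ nearest is x ‖ ≤ ‖ F x -ᴱ c i x ‖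
    nearest-≤ {i} (here {xs = is} ≡.refl) x =
      choose-elim (λ v → ‖ F x -ᴱ v ‖ ≤ ‖ F x -ᴱ c i x ‖) (λ _ → ≤.refl) ≮⇒≥
    nearest-≤ (there {x = j} {xs = is} i∈is) x = ≤.trans (nearest-step j is x) (nearest-≤ i∈is x)

-- Bochner integrals as limits of simple integrals

module BochnerProperties (em : ∀ {a} → ExcludedMiddle a) {ℓ} {ℝ : CompleteOrderedField ℓ} (M : MeasureSpace ℝ)
                         (E : BanachSpace ℝ) where
  open CompleteOrderedField ℝ hiding (zero)
  open OrderedField em ℝ
  open BanachSpace E
  open Norm em ℝ E
  open ExtendedReals ℝ
  open ExtendedRealProperties ℝ
  open MeasureSpace M
  open MeasureProperties em M
  open NormedSteps em M E
  open SimpleFunctions em M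
  open Lebesgue em M
  open Domination em M
  open StronglyMeasurable em M E
  open Integration em M
  open Bochner E
  open ≤-Reasoning

  ·ᴱ-zero : ∀ c {v} → v ≈ᴹ 0ᴹ → c ·ᴱ v ≈ᴹ 0ᴹ
  ·ᴱ-zero [ c , _ ] v≈0 = ≈ᴹ-trans (*ₗ-congˡ v≈0) (*ₗ-zeroʳ c)
  ·ᴱ-zero ∞         _   = ≈ᴹ-refl

  ·ᴱ-toReal : ∀ c v → c ≢ ∞ → c ·ᴱ v ≈ᴹ toReal c *ₗ v
  ·ᴱ-toReal [ _ ] v _   = ≈ᴹ-refl
  ·ᴱ-toReal ∞     v c≢∞ = ⊥-elim (c≢∞ ≡.refl)

  module _ {s : Point → Carrierᴹ} (fibre : ∀ v → Measurable (λ x → s x ≈ᴹ v)) where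
    sum≈integral : ∀ vs ps → foldr _+ᴹ_ 0ᴹ (map (λ v → μ _ (fibre v) ·ᴱ v) vs) ≈ᴹ
                   E-Steps.integral (simple-step ≈ᴹ-setoid leftModule (λ v → v) (λ e → e) {s} fibre vs ps)
    sum≈integral []       []       = ≈ᴹ-refl
    sum≈integral (v ∷ vs) (p ∷ ps) with em {P = v ≈ᴹ 0ᴹ}
    ... | yes v≈0 = ≈ᴹ-trans (+ᴹ-cong (·ᴱ-zero (μ _ (fibre v)) v≈0) (sum≈integral vs ps)) (+ᴹ-identityˡ _)
    ... | no v≉0  = +ᴹ-cong (·ᴱ-toReal (μ _ (fibre v)) v (p v≉0)) (sum≈integral vs ps)

  integrable-step : ∀ {s} (s-int : IntegrableSimple s) → Σ[ L ∈ E-Steps.Step ]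
                    (∀ x → E-Steps.⟦ L ⟧ x ≈ᴹ s x) × simpleIntegral s-int ≈ᴹ E-Steps.integral L
  integrable-step {s} s-int = simple-step ≈ᴹ-setoid leftModule (λ v → v) (λ e → e) {s} fibre values finites
    , (λ x → simple-step-∈ ≈ᴹ-setoid leftModule (λ v → v) (λ e → e) {s} fibre values finites unique (range x))
    , sum≈integral {s} fibre values finites
    where
    open IntegrableSimple s-int
    finites : All (FiniteFibre ≈ᴹ-setoid leftModule (λ v → v) (λ e → e) {s} fibre) values
    finites = All.universal finiteFibres values

  -- ‖s - t‖ is itself simple, hence its own minorant, and the bound on `∫⁺` yields a step function
  -- equal to it.
  simpleIntegral-distance : ∀ {s t a 0≤a} (s-int : IntegrableSimple s) (t-int : IntegrableSimple t) →
    ∫⁺ (λ x → ‖ s x -ᴱ t x ‖) ≤⁺ [ a , 0≤a ] → ‖ simpleIntegral s-int -ᴱ simpleIntegral t-int ‖ ≤ a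
  simpleIntegral-distance {s} {t} {a} s-int t-int ∫≤a =
    let Lₛ , rep-s , Is≈ = integrable-step s-int
        Lₜ , rep-t , It≈ = integrable-step t-int
        R , rep , IR≤a   = minorant-step ∫≤a distance
        L                = Lₛ ++ mapStep -ᴹ_ Lₜ
    in begin
      ‖ simpleIntegral s-int -ᴱ simpleIntegral t-int ‖
        ≈⟨ ‖‖-cong (≈ᴹ-trans (-ᴱ-cong Is≈ It≈) (≈ᴹ-sym (≈ᴹ-trans (integral-++ Lₛ _) (+ᴹ-congˡ (integral-neg Lₜ))))) ⟩
      ‖ integral L ‖
        ≤⟨ ‖integral‖-≤ L R (λ x → ≤.reflexive (trans (‖‖-cong (≈ᴹ-trans (⟦++⟧ Lₛ _ x)
             (+ᴹ-cong (rep-s x) (≈ᴹ-trans (⟦neg⟧ Lₜ x) (-ᴹ‿cong (rep-t x)))))) (sym (at rep x)))) ⟩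
      ℝ-Steps.integral R
        ≤⟨ IR≤a ⟩
      a ∎
    where
    open E-Steps
    open StepMap em M leftModule leftModule
    -0≈0 : -ᴹ 0ᴹ ≈ᴹ 0ᴹ
    -0≈0 = ≈ᴹ-trans (≈ᴹ-sym (-1*ₗ 0ᴹ)) (*ₗ-zeroʳ (- 1#))
    -+ : ∀ u v → -ᴹ (u +ᴹ v) ≈ᴹ (-ᴹ u) +ᴹ (-ᴹ v)
    -+ u v = ≈ᴹ-trans (≈ᴹ-sym (-1*ₗ _)) (≈ᴹ-trans (*ₗ-distribˡ (- 1#) u v) (+ᴹ-cong (-1*ₗ u) (-1*ₗ v)))
    -* : ∀ c v → -ᴹ (c *ₗ v) ≈ᴹ c *ₗ (-ᴹ v)
    -* c v = ≈ᴹ-trans (≈ᴹ-sym (-1*ₗ _)) (≈ᴹ-trans (≈ᴹ-sym (*ₗ-assoc (- 1#) c v)) (≈ᴹ-trans (*ₗ-congʳ (*-comm (- 1#) c))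
      (≈ᴹ-trans (*ₗ-assoc c (- 1#) v) (*ₗ-congˡ (-1*ₗ v)))))
    ⟦neg⟧ : ∀ L x → ⟦ mapStep -ᴹ_ L ⟧ x ≈ᴹ -ᴹ ⟦ L ⟧ x
    ⟦neg⟧ = mapStep-⟦⟧ -ᴹ_ -0≈0 -+ -*
    integral-neg : ∀ L → integral (mapStep -ᴹ_ L) ≈ᴹ -ᴹ integral L
    integral-neg = mapStep-integral -ᴹ_ -0≈0 -+ -*
    distance : Minorant (λ x → ‖ s x -ᴱ t x ‖)
    distance = record
      { function = λ x → ‖ s x -ᴱ t x ‖ , ‖‖-nonneg _
      ; isSimple = map₂-simple ≈ᴹ-setoid ≈ᴹ-setoid ℝ≥0-setoid (IntegrableSimple.isSimple s-int) (IntegrableSimple.isSimple t-int)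
          (λ u v → ‖ u -ᴱ v ‖ , ‖‖-nonneg _) (λ p q → ‖‖-cong (-ᴱ-cong p q))
      ; below    = λ x → ≤.refl
      }

  bochner-tame : ∀ {f} → BochnerIntegrable f → Tame f
  bochner-tame f-int = tame-limit (λ n → simple⇒tame (IntegrableSimple.isSimple (isIntegrable n))) pointwise
    where open BochnerIntegrable f-int

  lim-spec : ∀ {u} → ∃ (u ⟶_) → u ⟶ lim u
  lim-spec {u} c with em {P = ∃[ l ] u ⟶ l}
  ... | yes (l , u⟶l) = u⟶l
  ... | no ¬c         = ⊥-elim (¬c c)

  dbl : Carrier → Carrier
  dbl x = x + x

  dbl-nonneg : ∀ {x} → 0# ≤ x → 0# ≤ dbl x
  dbl-nonneg p = 0≤+ p p

  ≤dbl : ∀ {x} → 0# ≤ x → x ≤ dbl x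
  ≤dbl = x≤x+y

  dbl-mono : ∀ {x y} → x ≤ y → dbl x ≤ dbl y
  dbl-mono p = +-mono-≤ p p

  -- Each use of `∫⁺-quasi-subadditive` costs doublings, so ε divided by a power of 2 is prepared in
  -- advance.
  shrink : ∀ k {ε} → 0# < ε → ∃[ δ ] 0# < δ × iterate dbl δ k ≈ ε
  shrink zero    {ε} 0<ε = ε , 0<ε , refl
  shrink (suc k) 0<ε =
    let η , 0<η , eq₁ = shrink k 0<ε
        δ , 0<δ , eq₂ = halve⁺ 0<η
    in δ , 0<δ , trans (iterate-cong k eq₂) eq₁
    where
    iterate-cong : ∀ k {x y} → x ≈ y → iterate dbl x k ≈ iterate dbl y k
    iterate-cong zero    e = e
    iterate-cong (suc k) e = iterate-cong k (+-cong e e)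

  ∫⁺-triangle : ∀ {f s t : Point → Carrierᴹ} {a 0≤a} → Tame f → Tame s →
    ∫⁺ (λ x → ‖ f x -ᴱ s x ‖) ≤⁺ [ a , 0≤a ] → ∫⁺ (λ x → ‖ f x -ᴱ t x ‖) ≤⁺ [ a , 0≤a ] →
    ∀ {0≤c} → ∫⁺ (λ x → ‖ s x -ᴱ t x ‖) ≤⁺ [ dbl (dbl a) , 0≤c ]
  ∫⁺-triangle {f} {s} {t} f-tame s-tame p q = ∫⁺-quasi-subadditive (tame-distance f-tame s-tame)
    (λ x → ‖‖-nonneg _) (λ x → ‖‖-nonneg _) (λ x → dist-triangleˡ (s x) (f x) (t x)) p q

  ∫-converges : ∀ {f} (f-int : BochnerIntegrable f) →
                (λ n → simpleIntegral (BochnerIntegrable.isIntegrable f-int n)) ⟶ ∫ f f-int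
  ∫-converges {f} f-int = lim-spec (banach _ λ ε 0<ε →
    -- The triangle estimate turns δ into 4δ; the third doubling makes the inequality strict.
    let δ , 0<δ , eq = shrink 3 0<ε
        0≤δ          = proj₁ 0<δ
        N , close    = inMean δ 0<δ 0≤δ
        0<4δ         = 0<+ (0<+ 0<δ 0<δ) (0<+ 0<δ 0<δ)
    in N , λ m n N≤m N≤n → begin-strict
      ‖ simpleIntegral (isIntegrable m) -ᴱ simpleIntegral (isIntegrable n) ‖
        ≤⟨ simpleIntegral-distance (isIntegrable m) (isIntegrable n)
             (∫⁺-triangle {0≤a = 0≤δ} (bochner-tame f-int) (simple⇒tame (IntegrableSimple.isSimple (isIntegrable m)))
               (close m N≤m) (close n N≤n) {proj₁ 0<4δ}) ⟩
      dbl (dbl δ)           <⟨ x<x+y 0<4δ ⟩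
      dbl (dbl (dbl δ))     ≈⟨ eq ⟩
      ε                     ∎)
    where open BochnerIntegrable f-int

  -- Dominated sequences: the limit function and its integral

  module _ {g : Point → Carrier} (0≤g : ∀ x → 0# ≤ g x) (∫g≢∞ : ∫⁺ g ≢ ∞) where

    -- Chebyshev's argument: half of ‖v‖ on the fibre of v is a minorant of g, so a finite integral
    -- of g forces a finite fibre. The factor 2 occurs because an approximant is bounded by ‖f∞‖
    -- plus its error, both at most g.
    dominated-simple-integrable : ∀ {s} → Simple ≈ᴹ-setoid s → (∀ x → ‖ s x ‖ ≤ g x + g x) → IntegrableSimple s
    dominated-simple-integrable {s} s-simple s≤2g = record { isSimple = s-simple ; finiteFibres = finite-fibre }
      where
      open IsSimple s-simple using (fibre)
      finite-fibre : ∀ v → v ≉ᴹ 0ᴹ → μ _ (fibre v) ≢ ∞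
      finite-fibre v v≉0 =
        let L , L-rep , _ = minorant-step (≤-toReal ∫g≢∞ (toReal-nonneg (∫⁺ g))) φ
        in ℝ-Steps.nonzero-finite L (_ , fibre v) λ {x} sx≈v Lx≈0 → v≉0 (‖‖-definite v (begin-equality
          ‖ v ‖              ≈⟨ proj₂ (halve ‖ v ‖) ⟨
          c + c              ≈⟨ +-cong (c≈0 sx≈v (trans (sym (at L-rep x)) Lx≈0)) (c≈0 sx≈v (trans (sym (at L-rep x)) Lx≈0)) ⟩
          0# + 0#            ≈⟨ +-identityʳ 0# ⟩
          0#                 ∎))
        where
        ½‖v‖ 0ℝ≥0 : ℝ≥0
        ½‖v‖ = halfℝ≥0 (‖ v ‖ , ‖‖-nonneg v)
        0ℝ≥0 = 0# , ≤.refl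
        c = proj₁ ½‖v‖
        A : Pred Point ℓ
        A x = s x ≈ᴹ v
        φ : Minorant g
        φ = record
          { function = λ x → choose A ½‖v‖ 0ℝ≥0 x
          ; isSimple = choose-simple ℝ≥0-setoid (fibre v) (constant-simple ℝ≥0-setoid _) (constant-simple ℝ≥0-setoid _)
          ; below    = λ x → choose-elim (λ y → proj₁ y ≤ g x)
              (λ sx≈v → double-cancel-≤ (≤.trans (≤.reflexive (trans (proj₂ (halve ‖ v ‖)) (‖‖-cong (≈ᴹ-sym sx≈v)))) (s≤2g x)))
              (λ _ → 0≤g x)
          }
        c≈0 : ∀ {x} → s x ≈ᴹ v → proj₁ (choose A ½‖v‖ 0ℝ≥0 x) ≈ 0# → c ≈ 0#
        c≈0 sx≈v e = trans (reflexive (≡.cong proj₁ (≡.sym (choose-∈ sx≈v)))) e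

    module _ {f : ℕ → Point → Carrierᴹ} (f-int : ∀ n → BochnerIntegrable (f n)) {f∞ : Point → Carrierᴹ}
             (f⟶f∞ : ∀ x → (λ n → f n x) ⟶ f∞ x) (f≤g : ∀ n x → ‖ f n x ‖ ≤ g x) where

      f∞-tame : Tame f∞
      f∞-tame = tame-limit (λ n → bochner-tame (f-int n)) f⟶f∞

      f∞≤g : ∀ x → ‖ f∞ x ‖ ≤ g x
      f∞≤g x = ‖‖-limit-≤ (f⟶f∞ x) (λ n → f≤g n x)

      candidate : ℕ × ℕ → Point → Carrierᴹ
      candidate (n , m) = BochnerIntegrable.approx (f-int n) m

      -- Every pair (n , m) lies in the k × k square for all large k, so each candidate competes
      -- from some k onwards.
      approximant : ℕ → Point → Carrierᴹ
      approximant k = nearest f∞ candidate (cartesianProduct (upTo k) (upTo k))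

      approximant-simple : ∀ k → Simple ≈ᴹ-setoid (approximant k)
      approximant-simple k = nearest-simple f∞ candidate f∞-tame
        (λ (n , m) → IntegrableSimple.isSimple (BochnerIntegrable.isIntegrable (f-int n) m)) (cartesianProduct (upTo k) (upTo k))

      approximant-error : ∀ k x → ‖ f∞ x -ᴱ approximant k x ‖ ≤ g x
      approximant-error k x = ≤.trans (nearest-≤-norm f∞ candidate (cartesianProduct (upTo k) (upTo k)) x) (f∞≤g x)

      approximant-integrable : ∀ k → IntegrableSimple (approximant k)
      approximant-integrable k = dominated-simple-integrable (approximant-simple k) λ x →
        ≤.trans (‖‖-near (approximant k x) (f∞ x)) (+-mono-≤ (f∞≤g x) (approximant-error k x))

      approximant-converges : ∀ x ε → 0# < ε → ∃[ N ] ∀ k → N ℕ.≤ k → ‖ f∞ x -ᴱ approximant k x ‖ < ε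
      approximant-converges x ε 0<ε =
        let δ , 0<δ , δ+δ≈ε = halve⁺ 0<ε
            n , close₁      = f⟶f∞ x δ 0<δ
            m , close₂      = BochnerIntegrable.pointwise (f-int n) x δ 0<δ
        -- `upTo k` stops before k, so k must exceed both n and m.
        in suc (n ℕ.+ m) , λ k n+m<k → begin-strict
          ‖ f∞ x -ᴱ approximant k x ‖
            ≤⟨ nearest-≤ f∞ candidate (∈-cartesianProduct⁺
                 (∈-upTo⁺ (ℕ.≤-<-trans (ℕ.m≤m+n n m) n+m<k)) (∈-upTo⁺ (ℕ.≤-<-trans (ℕ.m≤n+m m n) n+m<k))) x ⟩
          ‖ f∞ x -ᴱ candidate (n , m) x ‖
            ≤⟨ dist-triangle (f∞ x) (f n x) _ ⟩
          ‖ f∞ x -ᴱ f n x ‖ + ‖ f n x -ᴱ candidate (n , m) x ‖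
            ≈⟨ +-cong (dist-sym _ _) (dist-sym _ _) ⟩
          ‖ f n x -ᴱ f∞ x ‖ + ‖ candidate (n , m) x -ᴱ f n x ‖
            <⟨ +-monoˡ-< (close₁ n ℕ.≤-refl) (proj₁ (close₂ m ℕ.≤-refl)) ⟩
          δ + δ
            ≈⟨ δ+δ≈ε ⟩
          ε ∎

      limit-integrable : BochnerIntegrable f∞
      limit-integrable = record
        { approx       = approximant
        ; isIntegrable = approximant-integrable
        ; pointwise    = λ x ε 0<ε → let N , close = approximant-converges x ε 0<ε in
            N , λ k N≤k → ≤-<-trans (≤.reflexive (dist-sym _ _)) (close k N≤k)
        ; inMean       = dominated-convergence 0≤g ∫g≢∞ (λ k x → ‖ f∞ x -ᴱ approximant k x ‖)
            (λ k → tame-distance f∞-tame (simple⇒tame (approximant-simple k))) approximant-error approximant-converges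
        }

      -- Halving the distance keeps it below g itself.
      half-distance : ℕ → Point → Carrier
      half-distance n x = proj₁ (halfℝ≥0 (‖ f n x -ᴱ f∞ x ‖ , ‖‖-nonneg _))

      half-distance-double : ∀ n x → half-distance n x + half-distance n x ≈ ‖ f n x -ᴱ f∞ x ‖
      half-distance-double n x = half+half (‖ f n x -ᴱ f∞ x ‖ , ‖‖-nonneg _)

      half-distance-nonneg : ∀ n x → 0# ≤ half-distance n x
      half-distance-nonneg n x = proj₂ (halfℝ≥0 (‖ f n x -ᴱ f∞ x ‖ , ‖‖-nonneg _))

      half-distance-measurable : ∀ n → MeasurableFunction (half-distance n)
      half-distance-measurable n c = resp-≐
        ((λ {x} d<2c → ≰⇒> λ c≤h → <⇒≱ d<2c (≤.trans (dbl-mono c≤h) (≤.reflexive (half-distance-double n x)))) ,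
         (λ {x} h<c → ≤-<-trans (≤.reflexive (sym (half-distance-double n x))) (+-monoˡ-< h<c (proj₁ h<c))))
        (tame-distance (bochner-tame (f-int n)) f∞-tame (dbl c))

      half-distance-mean : (λ n → ∫⁺ (half-distance n)) ⟶0
      half-distance-mean = dominated-convergence 0≤g ∫g≢∞ half-distance half-distance-measurable
        (λ n x → double-cancel-≤ (≤.trans (≤.reflexive (half-distance-double n x))
          (≤.trans (dist-diff (f n x) (f∞ x)) (+-mono-≤ (f≤g n x) (f∞≤g x)))))
        λ x ε 0<ε → let N , close = f⟶f∞ x ε 0<ε in N , λ n N≤n →
          ≤-<-trans (≤.trans (≤dbl (half-distance-nonneg n x)) (≤.reflexive (half-distance-double n x))) (close n N≤n)

      -- The witness for f∞ is arbitrary. For each n, simple functions s and t from the two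
      -- approximating sequences are taken at a common index, and ‖s - t‖ is estimated along s, f n,
      -- f∞, t.
      integrals-converge : (f∞-int : BochnerIntegrable f∞) → (λ n → ∫ (f n) (f-int n)) ⟶ ∫ f∞ f∞-int
      integrals-converge f∞-int ε 0<ε =
        -- `inner` and `outer` are bounded by 4δ each, hence `total` by 16δ. The two limits of
        -- simple integrals add 2δ, and 18δ ≤ 32δ.
        let δ , 0<δ , eq = shrink 5 0<ε
            N , small    = half-distance-mean δ 0<δ (proj₁ 0<δ)
        in N , λ n N≤n → bound n 0<δ eq (small n N≤n)
        where
        module F∞ = BochnerIntegrable f∞-int
        bound : ∀ n {δ} (0<δ : 0# < δ) → iterate dbl δ 5 ≈ ε → ∫⁺ (half-distance n) ≤⁺ [ δ , proj₁ 0<δ ] →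
                ‖ ∫ (f n) (f-int n) -ᴱ ∫ f∞ f∞-int ‖ < ε
        bound n {δ} 0<δ eq ∫h≤δ =
          let N₁ , s-mean = F.inMean δ 0<δ 0≤δ
              N₂ , t-mean = F∞.inMean δ 0<δ 0≤δ
              N₃ , s-int  = ∫-converges (f-int n) δ 0<δ
              N₄ , t-int  = ∫-converges f∞-int δ 0<δ
              k           = (N₁ ℕ.+ N₂) ℕ.+ (N₃ ℕ.+ N₄)
              N₁≤k        = ℕ.≤-trans (ℕ.m≤m+n N₁ N₂) (ℕ.m≤m+n _ _)
              N₂≤k        = ℕ.≤-trans (ℕ.m≤n+m N₂ N₁) (ℕ.m≤m+n _ _)
              N₃≤k        = ℕ.≤-trans (ℕ.m≤m+n N₃ N₄) (ℕ.m≤n+m _ (N₁ ℕ.+ N₂))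
              N₄≤k        = ℕ.≤-trans (ℕ.m≤n+m N₄ N₃) (ℕ.m≤n+m _ (N₁ ℕ.+ N₂))
              s           = F.approx k
              t           = F∞.approx k
              Iₛ          = simpleIntegral (F.isIntegrable k)
              Iₜ          = simpleIntegral (F∞.isIntegrable k)
              outer       = ∫⁺-quasi-subadditive {h = λ x → ‖ f n x -ᴱ s x ‖ + ‖ f∞ x -ᴱ t x ‖} {0≤a = 0≤δ} {0≤b = 0≤δ}
                              (tame-distance (bochner-tame (f-int n)) (simple⇒tame (IntegrableSimple.isSimple (F.isIntegrable k))))
                              (λ x → ‖‖-nonneg _) (λ x → ‖‖-nonneg _) (λ x → ≤.refl) (s-mean k N₁≤k) (t-mean k N₂≤k) {0≤4δ}
              inner       = ∫⁺-quasi-subadditive {h = λ x → ‖ f n x -ᴱ f∞ x ‖}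
                              (half-distance-measurable n) (half-distance-nonneg n) (half-distance-nonneg n)
                              (λ x → ≤.reflexive (sym (half-distance-double n x))) ∫h≤δ ∫h≤δ {0≤4δ}
              total       = ∫⁺-quasi-subadditive {h = λ x → ‖ s x -ᴱ t x ‖} (tame-distance (bochner-tame (f-int n)) f∞-tame)
                              (λ x → ‖‖-nonneg _) (λ x → 0≤+ (‖‖-nonneg _) (‖‖-nonneg _)) (λ x → pentagon (s x) (t x) (f n x) (f∞ x))
                              inner outer {dbl-nonneg (dbl-nonneg 0≤4δ)}
          in begin-strict
            ‖ ∫ (f n) (f-int n) -ᴱ ∫ f∞ f∞-int ‖
              ≤⟨ dist-triangleˡ _ Iₛ _ ⟩
            ‖ Iₛ -ᴱ ∫ (f n) (f-int n) ‖ + ‖ Iₛ -ᴱ ∫ f∞ f∞-int ‖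
              <⟨ +-monoˡ-< (s-int k N₃≤k) (dist-triangle _ Iₜ _) ⟩
            δ + (‖ Iₛ -ᴱ Iₜ ‖ + ‖ Iₜ -ᴱ ∫ f∞ f∞-int ‖)
              ≤⟨ +-monoʳ-≤ δ (+-mono-≤ (simpleIntegral-distance (F.isIntegrable k) (F∞.isIntegrable k) total) (proj₁ (t-int k N₄≤k))) ⟩
            δ + (16δ + δ)
              ≈⟨ solve 2 (λ a b → a :+ (b :+ a) := (a :+ a) :+ b) refl δ 16δ ⟩
            dbl δ + 16δ
              ≤⟨ +-mono-≤ (≤.trans (≤dbl (dbl-nonneg 0≤δ)) (≤.trans (≤dbl 0≤4δ) (≤dbl (dbl-nonneg 0≤4δ)))) ≤.refl ⟩
            dbl 16δ
              ≈⟨ eq ⟩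
            ε ∎
          where
          module F = BochnerIntegrable (f-int n)
          open Solver using (solve; _:=_; _:+_)
          0≤δ  = proj₁ 0<δ
          0≤4δ = dbl-nonneg (dbl-nonneg 0≤δ)
          16δ  = dbl (dbl (dbl (dbl δ)))
          pentagon : ∀ s t u v → ‖ s -ᴱ t ‖ ≤ ‖ u -ᴱ v ‖ + (‖ u -ᴱ s ‖ + ‖ v -ᴱ t ‖)
          pentagon s t u v = begin
            ‖ s -ᴱ t ‖                                    ≤⟨ dist-triangleˡ s u t ⟩
            ‖ u -ᴱ s ‖ + ‖ u -ᴱ t ‖                       ≤⟨ +-monoʳ-≤ _ (dist-triangle u v t) ⟩
            ‖ u -ᴱ s ‖ + (‖ u -ᴱ v ‖ + ‖ v -ᴱ t ‖)        ≈⟨ solve 3 (λ a b c → a :+ (b :+ c) := b :+ (a :+ c)) refl _ _ _ ⟩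
            ‖ u -ᴱ v ‖ + (‖ u -ᴱ s ‖ + ‖ v -ᴱ t ‖)        ∎

theorem12 :
    (em : ∀ {a} → ExcludedMiddle a) →
    ∀ {ℓ} (ℝ : CompleteOrderedField ℓ) (M : MeasureSpace ℝ) (E : BanachSpace ℝ) →
    let open CompleteOrderedField ℝ
        open BanachSpace E
        open MeasureSpace M using (Point)
        open Integration em M
        open Bochner E
    in
    (g : Point → Carrier) → (∀ x → 0# ≤ g x) → NonnegIntegrable g →
    (f : ℕ → Point → Carrierᴹ) (f-int : ∀ n → BochnerIntegrable (f n)) →
    (f∞ : Point → Carrierᴹ) → (∀ x → (λ n → f n x) ⟶ f∞ x) →
    (∀ n x → ‖ f n x ‖ ≤ g x) →
    BochnerIntegrable f∞ ×
    ((f∞-int : BochnerIntegrable f∞) → (λ n → ∫ (f n) (f-int n)) ⟶ ∫ f∞ f∞-int)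
theorem12 em ℝ M E g 0≤g (_ , ∫g≢∞) f f-int f∞ f⟶f∞ f≤g =
  limit-integrable 0≤g ∫g≢∞ f-int f⟶f∞ f≤g , integrals-converge 0≤g ∫g≢∞ f-int f⟶f∞ f≤g
  where open BochnerProperties em M E
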